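{- Let $G=(V,E)$ be a directed graph with $m=|E|$, let $H$ be a maximal eulerian subgraph of $G$, and let $r:V\to\mathbb{Z}$ be a rank function conforming $H$ such that $\mathrm{slack}(e,r)\le m$ for every edge $e\in E(H)$. Then the algorithm $\mathrm{MinAgony}(G,H,r)$ takes $O(m^2)$ time.
   Context: Graphs are finite and directed, $G=(V,E)$, $n=|V|$, $m=|E|$; subgraphs of $G$ are taken on the same vertex set $V$, and $E(H)$ is the edge set of $H$. A rank function is a map $r:V\to\mathbb{Z}$. An edge $(u,v)$ is forward w.r.t. $r$ if $r(u)<r(v)$ and backward if $r(u)\ge r(v)$. Agony: $q((u,v),r)=\max(r(u)-r(v)+1,0)$ and $q(G,r)=\sum_{e\in E}q(e,r)$. Slack: $\mathrm{slack}((u,v),r)=\max(r(v)-r(u)-1,0)$. A graph is eulerian if every vertex has in-degree equal to out-degree (connectivity is not required). A subgraph $H$ of $G$ is a maximal eulerian subgraph if it is eulerian and no eulerian subgraph of $G$ has an edge set strictly containing $E(H)$. A rank function $r$ conforms $H$ if all edges of $G$ that are backward w.r.t. $r$ lie in $E(H)$. Algorithm Relief$(H,r,G,p,s)$. Input: a graph $G=(V,E)$, a maximal eulerian subgraph $H$, a rank function $r$ conforming $H$, and an edge $(p,s)\in E(H)$ with $\mathrm{slack}((p,s),r)>0$. (1) Set $F:=E(H)$, $r':=r$, $t(v):=0$ for all $v\in V$; then set $t(p):=r(s)-r(p)-1$ and let $S$ be a priority queue (largest priority first) containing only $p$, with priority $t(p)$. (2) While $S$ is not empty: pop a vertex $u$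 of highest priority from $S$ and set $r'(u):=r'(u)+t(u)$. For each $(u,v)\in E\setminus F$ with $r'(v)\le r'(u)$: let $t:=r'(u)+1-r'(v)$; if $t>t(v)$, set $t(v):=t$, add $v$ to $S$ with priority $t$ (updating its priority if $v$ is already in $S$), and set $\mathrm{parent}(v):=u$. Then for each $e=(w,u)\in F$ with $\mathrm{slack}(e,r')>\mathrm{slack}(e,r)$: let $t:=\mathrm{slack}(e,r')-\mathrm{slack}(e,r)$; if $t>t(w)$, set $t(w):=t$, add $w$ to $S$ with priority $t$ (updating its priority if $w$ is already in $S$), and set $\mathrm{parent}(w):=u$. (3) After the loop, if $\mathrm{slack}((p,s),r')>0$: let $O$ be the set of edges of $E$ along the path from $s$ to $p$ obtained by following the parent links (for each vertex $x\ne p$ on this path, the edge joining $x$ and $\mathrm{parent}(x)$ is the one that was being processed when $\mathrm{parent}(x)$ was last set); replace $F$ by $(F\setminus O)\cup(O\setminus F)$ and then delete $(p,s)$ from $F$. (4) Return $H'=(V,F)$ and $r'$. Algorithm MinAgony$(G,H,r)$: while $q(G,r)>|E(H)|$, pick an edge $(p,s)\in E(H)$ with largest slack w.r.t. $r$ and replace $(H,r)$ by the output of Relief$(H,r,G,p,s)$. Return $H,r$. Running time counts elementary operations (integer arithmetic and comparisons at unit cost), the priority queue being implemented by a suitable data structure. In running-time bounds, $n=O(m)$ is understood, so $O(n+m)$ is written $O(m)$. -}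

module Defs where

open import Data.Fin.Base using (Fin)
open import Data.Fin.Properties using (_≟_)
open import Data.Fin.Subset
  using (Subset; _∈_; _∉_; _⊂_; Empty; Nonempty; _∩_; _∪_; _─_; _-_; ⁅_⁆; ⊥; ∣_∣)
open import Data.Integer.Base as ℤ using (ℤ; +_; 0ℤ; 1ℤ)
open import Data.Integer.Properties using (+-0-commutativeMonoid)
open import Data.Maybe.Base using (Maybe; just; nothing)
open import Data.Nat.Base using (ℕ; _+_; _≤_)
open import Data.Product.Base using (_×_; _,_; ∃₂)
open import Data.Sum.Base using (_⊎_)
open import Data.Vec.Base using (tabulate)
open import Data.Vec.Functional using (updateAt)
open import Function.Base using (const)
open import Relation.Binary.PropositionalEquality.Core using (_≡_; _≢_)
open import Relation.Nullary.Decidable.Core using (does)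
open import Relation.Nullary.Negation.Core using (¬_)

open import Algebra.Properties.CommutativeMonoid.Sum +-0-commutativeMonoid using (sum)

-- Vertices are Fin n and edges are Fin m.  By `simple` an edge is determined
-- by its pair of endpoints, so E is a subset of V × V (loops are allowed).
record Graph : Set where
  field
    n m     : ℕ
    src tgt : Fin m → Fin n
    simple  : ∀ {e f} → src e ≡ src f → tgt e ≡ tgt f → e ≡ f

module _ (G : Graph) where
  open Graph G

  -- Subgraphs live on the whole vertex set, so one is given by its edge set,
  -- a `Subset m`.

  outEdges inEdges : Fin n → Subset m
  outEdges v = tabulate λ e → does (src e ≟ v)
  inEdges  v = tabulate λ e → does (tgt e ≟ v)

  Eulerian : Subset m → Set
  Eulerian H = ∀ v → ∣ H ∩ inEdges v ∣ ≡ ∣ H ∩ outEdges v ∣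

  MaximalEulerian : Subset m → Set
  MaximalEulerian H = Eulerian H × (∀ H′ → Eulerian H′ → ¬ (H ⊂ H′))

  Rank : Set
  Rank = Fin n → ℤ

  Backward : Fin m → Rank → Set
  Backward e r = r (tgt e) ℤ.≤ r (src e)

  Conforms : Rank → Subset m → Set
  Conforms r H = ∀ e → Backward e r → e ∈ H

  edgeAgony : Fin m → Rank → ℤ
  edgeAgony e r = (r (src e) ℤ.- r (tgt e) ℤ.+ 1ℤ) ℤ.⊔ 0ℤ

  agony : Rank → ℤ
  agony r = sum λ e → edgeAgony e r

  slack : Fin m → Rank → ℤ
  slack e r = (r (tgt e) ℤ.- r (src e) ℤ.- 1ℤ) ℤ.⊔ 0ℤ

  -- The algorithms are given as a transition system with costs.  Choices that
  -- the pseudocode leaves open (ties, order of iteration over edges) are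
  -- nondeterministic.  Edge sets and vertex-indexed maps are arrays, edges
  -- are accessible from both endpoints through incidence lists, and S carries
  -- a counter of its elements.  A label counts elementary operations up to a
  -- constant factor: a transition that does a bounded number of them costs 1,
  -- and sums, maxima, copies and initialisations are charged one unit per
  -- entry in addition.
  --
  -- The priority queue is an array of doubly linked lists ("buckets"), indexed
  -- by the priorities 1, …, capacity, with a pointer `top` that is never below
  -- the highest priority present.  Inserting an element, moving it to another
  -- bucket, deleting it, and testing one bucket for emptiness are then O(1).

  -- The arguments of a call of Relief that are needed after its initialisation:
  -- the edge (p , s) and the rank function r.
  record Call : Set where
    constructor call
    field
      ps : Fin m
      r  : Rank

    p s : Fin n
    p = src ps
    s = tgt ps

    capacity : ℤ
    capacity = r s ℤ.- r p ℤ.- 1ℤ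

  -- The priority of v ∈ S is t v: the algorithm always sets the two together.
  -- parent v also records the edge that was being processed when it was set.
  record State : Set where
    constructor state
    field
      F      : Subset m
      r′     : Rank
      t      : Fin n → ℤ
      S      : Subset n
      parent : Fin n → Maybe (Fin n × Fin m)
      top    : ℤ

  open State

  initial : Call → Subset m → State
  initial κ H = record
    { F      = H
    ; r′     = r
    ; t      = updateAt (const 0ℤ) p (const capacity)
    ; S      = ⁅ p ⁆
    ; parent = const nothing
    ; top    = capacity
    } where open Call κ

  popped : Fin n → State → State
  popped u σ = record σ
    { r′ = updateAt (r′ σ) u (ℤ._+ t σ u)
    ; S  = S σ - u
    }

  push : (v : Fin n) (δ : ℤ) (u : Fin n) (e : Fin m) → State → State
  push v δ u e σ = record σ
    { t      = updateAt (t σ) v (const δ)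
    ; S      = S σ ∪ ⁅ v ⁆
    ; parent = updateAt (parent σ) v (const (just (u , e)))
    ; top    = top σ ℤ.⊔ δ
    }

  -- The increments t considered in step (2) for an out-edge e = (u , v) ∉ F and
  -- for an in-edge e = (w , u) ∈ F.
  outIncrement : State → Fin m → ℤ
  outIncrement σ e = r′ σ (src e) ℤ.+ 1ℤ ℤ.- r′ σ (tgt e)

  inIncrement : Call → State → Fin m → ℤ
  inIncrement κ σ e = slack e (r′ σ) ℤ.- slack e (Call.r κ)

  OutUpdate : State → Fin m → Set
  OutUpdate σ e =
    e ∉ F σ × r′ σ (tgt e) ℤ.≤ r′ σ (src e) × t σ (tgt e) ℤ.< outIncrement σ e

  InUpdate : Call → State → Fin m → Set
  InUpdate κ σ e =
    e ∈ F σ × slack e (Call.r κ) ℤ.< slack e (r′ σ) × t σ (src e) ℤ.< inIncrement κ σ e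

  data Config : Set where
    -- head of the loop of MinAgony
    test  : (H : Subset m) (r : Rank) → Config
    -- about to execute Relief(H, r, G, p, s)
    enter : (κ : Call) (H : Subset m) → Config
    -- head of the loop of Relief
    loop  : (κ : Call) (σ : State) → Config
    -- u has been popped; the edges in T remain to be processed
    outs  : (κ : Call) (σ : State) (u : Fin n) (T : Subset m) → Config
    ins   : (κ : Call) (σ : State) (u : Fin n) (T : Subset m) → Config
    -- following the parent links; x is the current vertex, O the edges so far
    walk  : (κ : Call) (σ : State) (x : Fin n) (O : Subset m) → Config
    halt  : (H : Subset m) (r : Rank) → Config

  infix 4 _—[_]→_ _—[_]↠_

  data _—[_]→_ : Config → ℕ → Config → Set where

    stop : ∀ {H r} →
      agony r ℤ.≤ + ∣ H ∣ →
      test H r —[ 1 + m + m ]→ halt H r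

    pick : ∀ {H r ps} →
      + ∣ H ∣ ℤ.< agony r →
      ps ∈ H → (∀ e → e ∈ H → slack e r ℤ.≤ slack ps r) →
      test H r —[ 1 + m + m + m ]→ enter (call ps r) H

    -- The arrays are F, then r′, t, S and parent, then the buckets.
    init : ∀ {κ H} →
      enter κ H —[ 1 + m + (n + n + n + n) + ℤ.∣ Call.capacity κ ∣ ]→ loop κ (initial κ H)

    -- The bucket at `top` is empty.
    descend : ∀ {κ σ} →
      Nonempty (S σ) → (∀ v → v ∈ S σ → t σ v ≢ top σ) →
      loop κ σ —[ 1 ]→ loop κ (record σ { top = top σ ℤ.- 1ℤ })

    pop : ∀ {κ σ u} →
      u ∈ S σ → (∀ v → v ∈ S σ → t σ v ℤ.≤ t σ u) → t σ u ≡ top σ →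
      loop κ σ —[ 1 ]→ outs κ (popped u σ) u (outEdges u)

    -- The bound by the capacity says that the bucket exists.
    out-update : ∀ {κ σ u T e} →
      e ∈ T → OutUpdate σ e → outIncrement σ e ℤ.≤ Call.capacity κ →
      outs κ σ u T —[ 1 ]→ outs κ (push (tgt e) (outIncrement σ e) u e σ) u (T - e)

    out-skip : ∀ {κ σ u T e} →
      e ∈ T → ¬ OutUpdate σ e →
      outs κ σ u T —[ 1 ]→ outs κ σ u (T - e)

    out-done : ∀ {κ σ u T} →
      Empty T →
      outs κ σ u T —[ 1 ]→ ins κ σ u (inEdges u)

    in-update : ∀ {κ σ u T e} →
      e ∈ T → InUpdate κ σ e → inIncrement κ σ e ℤ.≤ Call.capacity κ →
      ins κ σ u T —[ 1 ]→ ins κ (push (src e) (inIncrement κ σ e) u e σ) u (T - e)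

    in-skip : ∀ {κ σ u T e} →
      e ∈ T → ¬ InUpdate κ σ e →
      ins κ σ u T —[ 1 ]→ ins κ σ u (T - e)

    in-done : ∀ {κ σ u T} →
      Empty T →
      ins κ σ u T —[ 1 ]→ loop κ σ

    keep : ∀ {κ σ} →
      Empty (S σ) → slack (Call.ps κ) (r′ σ) ℤ.≤ 0ℤ →
      loop κ σ —[ 1 ]→ test (F σ) (r′ σ)

    modify : ∀ {κ σ} →
      Empty (S σ) → 0ℤ ℤ.< slack (Call.ps κ) (r′ σ) →
      loop κ σ —[ 1 + m ]→ walk κ σ (Call.s κ) ⊥

    follow : ∀ {κ σ x O y e} →
      x ≢ Call.p κ → parent σ x ≡ just (y , e) →
      walk κ σ x O —[ 1 ]→ walk κ σ y (O ∪ ⁅ e ⁆)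

    flip : ∀ {κ σ O} →
      walk κ σ (Call.p κ) O —[ 1 + m ]→
      test (((F σ ─ O) ∪ (O ─ F σ)) - Call.ps κ) (r′ σ)

  data _—[_]↠_ : Config → ℕ → Config → Set where
    []  : ∀ {x} → x —[ 0 ]↠ x
    _∷_ : ∀ {x y z j k} → x —[ j ]→ y → y —[ k ]↠ z → x —[ j + k ]↠ z

  Halted : Config → Set
  Halted x = ∃₂ λ H r → x ≡ halt H r

  -- Every execution of MinAgony(G, H, r) from its start costs at most b and,
  -- unless it has halted, can be continued.  As every transition has positive
  -- cost, every execution then halts.
  MinAgonyTakesAtMost : Subset m → Rank → ℕ → Set
  MinAgonyTakesAtMost H r b = ∀ {k x} → test H r —[ k ]↠ x →
    k ≤ b × (Halted x ⊎ ∃₂ λ j y → x —[ j ]→ y)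

{-# OPTIONS --safe #-}
module Submission where

open import Defs hiding ([]; _∷_)
open import Data.Bool.Base using (Bool; true; false; _∧_)
open import Data.Fin.Base using (Fin; zero; suc)
open import Data.Fin.Properties using (_≟_; any?)
open import Data.Fin.Subset
open import Data.Fin.Subset.Properties
open import Data.Integer.Base as ℤ using (ℤ; +_; 0ℤ; 1ℤ)
import Data.Integer.Properties as ℤ
open import Data.Integer.Tactic.RingSolver using (solve)
open import Data.Nat.Tactic.RingSolver using () renaming (solve to solveℕ)
open import Data.List.Base using ([]; _∷_)
open import Data.Maybe.Base using (just)
open import Data.Maybe.Properties using (just-injective)
open import Data.Nat.Base using (ℕ; zero; suc; _+_; _*_; _^_; pred; _≤_; _<_; z≤n; s≤s; s≤s⁻¹)
import Data.Nat.Properties as ℕ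
open import Data.Product.Base using (_×_; _,_; proj₁; proj₂; ∃; ∃₂; ∃-syntax)
open import Data.Sum.Base using (_⊎_; inj₁; inj₂; [_,_]; [_,_]′)
open import Data.Unit.Base as Unit using (tt)
open import Data.Vec.Base as Vec using (lookup; tabulate; here; there)
open import Data.Vec.Functional using (updateAt)
open import Data.Vec.Functional.Properties using (updateAt-updates; updateAt-minimal)
open import Data.Vec.Properties
  using (lookup∘tabulate; lookup⇒[]=; []=⇒lookup; lookup-zipWith)
open import Function.Base using (_∘_; const; id)
open import Relation.Binary.PropositionalEquality
  using (_≡_; _≢_; refl; sym; trans; cong; cong₂; subst; subst₂; module ≡-Reasoning)
open import Relation.Nullary using (¬_; Dec; yes; no; does; contradiction)
open import Relation.Nullary.Decidable using (dec-true; dec-false; _×-dec_; ¬?)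
open import Relation.Unary using (Pred; Decidable)
open import Algebra.Properties.CommutativeMonoid.Sum ℤ.+-0-commutativeMonoid
  using (sum; sum-cong-≗; ∑-distrib-+; ∑-comm; sum-replicate-zero)
open import Algebra.Properties.Semiring.Sum ℤ.+-*-semiring using (*-distribˡ-sum)

-- If F is eulerian and r conforms F, then q(G, r) − |F| is the total slack of F,
-- so the number of edges of F with positive slack decides termination.  A call
-- of Relief lowers this number: no vertex is popped twice, since the priorities
-- never exceed that of the last popped vertex; hence at the end every edge
-- outside F is forward and no slack in F has grown.  If (p , s) keeps positive
-- slack, then s was raised, and flipping the parent path from s to p, whose new
-- edges have slack 0 and whose deleted ones are forward, compensates for the
-- deletion of (p , s).  So there are at most m calls, each of cost O(n + m)
-- because the capacity, being a slack of F, stays at most m.  The cost is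
-- accounted for by a potential on configurations.

-- The priorities cannot increase for two reasons: an edge outside `F` is forward w.r.t. the old
-- ranks, so its strictness absorbs the `+ 1` in the increment; and raising the head of an edge by
-- some amount increases its slack by at most that amount. So the search behaves like Dijkstra's
-- algorithm with integer keys: the bucket pointer only descends, and its whole descent is bounded
-- by the capacity. The claim covers every partial execution, and it also requires that no execution
-- gets stuck. A missing bucket or a missing parent would be such a failure, so the same invariant
-- has to yield both the cost bound and progress. The obstacle is that during the search `r′` mixes
-- old and new ranks. The invariant is therefore phrased with the prospective ranks `R`, which only
-- rise and are frozen at popped vertices. Parent links may be overwritten while a vertex is queued,
-- so that they form a tree is not evident; a depth function certifies it, and works because only
-- popped vertices serve as parents.

private variable
  k : ℕ

-- Linear arithmetic over ℤ: `close` derives an inequality from a nonnegative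
-- combination of the gaps of known ones.

infixl 6 _⊞_

gap : ∀ {x y} → x ℤ.≤ y → 0ℤ ℤ.≤ y ℤ.- x
gap = ℤ.i≤j⇒0≤j-i

gap< : ∀ {x y} → x ℤ.< y → 0ℤ ℤ.≤ y ℤ.- (1ℤ ℤ.+ x)
gap< x<y = gap (ℤ.i<j⇒suc[i]≤j x<y)

_⊞_ : ∀ {x y} → 0ℤ ℤ.≤ x → 0ℤ ℤ.≤ y → 0ℤ ℤ.≤ x ℤ.+ y
_⊞_ = ℤ.+-mono-≤

close : ∀ {x y d} → 0ℤ ℤ.≤ d → y ℤ.- x ≡ d → x ℤ.≤ y
close 0≤d eq = ℤ.0≤i-j⇒j≤i (subst (0ℤ ℤ.≤_) (sym eq) 0≤d)

close< : ∀ {x y d} → 0ℤ ℤ.≤ d → y ℤ.- (1ℤ ℤ.+ x) ≡ d → x ℤ.< y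
close< 0≤d eq = ℤ.suc[i]≤j⇒i<j (close 0≤d eq)

-- Slack in terms of the ranks of the two ends: `slack G e r` unfolds to
-- `excess (r (src e)) (r (tgt e))`, so these facts apply to it directly, and one end can be varied
-- alone.
excess : ℤ → ℤ → ℤ
excess a b = (b ℤ.- a ℤ.- 1ℤ) ℤ.⊔ 0ℤ

excess-nonneg : ∀ a b → 0ℤ ℤ.≤ excess a b
excess-nonneg a b = ℤ.i≤j⊔i (b ℤ.- a ℤ.- 1ℤ) 0ℤ

excess-lower : ∀ a b → b ℤ.- a ℤ.- 1ℤ ℤ.≤ excess a b
excess-lower a b = ℤ.i≤i⊔j (b ℤ.- a ℤ.- 1ℤ) 0ℤ

excess-lub : ∀ a b {c} → b ℤ.- a ℤ.- 1ℤ ℤ.≤ c → 0ℤ ℤ.≤ c → excess a b ℤ.≤ c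
excess-lub a b = ℤ.⊔-lub

-- Exceeding a nonnegative number rules out the truncation at 0. The bound `c` is general because it
-- will be an earlier slack that has been outgrown.
excess-pos : ∀ a b {c} → 0ℤ ℤ.≤ c → c ℤ.< excess a b → excess a b ≡ b ℤ.- a ℤ.- 1ℤ
excess-pos a b {c} 0≤c c<x with ℤ.≤-total (b ℤ.- a ℤ.- 1ℤ) 0ℤ
... | inj₁ ≤0 = contradiction (ℤ.<-≤-trans (subst (c ℤ.<_) (ℤ.i≤j⇒i⊔j≡j ≤0) c<x) 0≤c) (ℤ.<-irrefl refl)
... | inj₂ 0≤ = ℤ.i≥j⇒i⊔j≡i 0≤

excess-pos⇒< : ∀ a b {c} → 0ℤ ℤ.≤ c → c ℤ.< excess a b → a ℤ.< b
excess-pos⇒< a b {c} 0≤c c<x =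
  close< (gap 0≤c ⊞ gap< (subst (c ℤ.<_) (excess-pos a b 0≤c c<x) c<x) ⊞ gap {0ℤ} {1ℤ} (ℤ.+≤+ z≤n))
    (solve (a ∷ b ∷ c ∷ []))

excess-mono : ∀ a b a′ b′ d → 0ℤ ℤ.≤ d → b ℤ.- a ℤ.≤ b′ ℤ.- a′ ℤ.+ d →
              excess a b ℤ.≤ excess a′ b′ ℤ.+ d
excess-mono a b a′ b′ d 0≤d h = excess-lub a b
  (ℤ.≤-trans {j = b′ ℤ.- a′ ℤ.- 1ℤ ℤ.+ d} (close (gap h) (solve (a ∷ b ∷ a′ ∷ b′ ∷ d ∷ [])))
             (ℤ.+-monoˡ-≤ d (excess-lower a′ b′)))
  (ℤ.+-mono-≤ (excess-nonneg a′ b′) 0≤d)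

excess-antitoneˡ : ∀ a a′ b → a ℤ.≤ a′ → excess a′ b ℤ.≤ excess a b
excess-antitoneˡ a a′ b a≤a′ = excess-lub a′ b
  (ℤ.≤-trans {j = b ℤ.- a ℤ.- 1ℤ} (close (gap a≤a′) (solve (a ∷ a′ ∷ b ∷ []))) (excess-lower a b))
  (excess-nonneg a b)

-- Finite sets and their sizes

∈-tabulate⁺ : ∀ {p} {P : Pred (Fin k) p} (P? : Decidable P) {i} → P i → i ∈ tabulate (does ∘ P?)
∈-tabulate⁺ P? {i} Pi = lookup⇒[]= i _ (trans (lookup∘tabulate (does ∘ P?) i) (dec-true (P? i) Pi))

∈-tabulate⁻ : ∀ {p} {P : Pred (Fin k) p} (P? : Decidable P) {i} → i ∈ tabulate (does ∘ P?) → P i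
∈-tabulate⁻ P? {i} i∈ with P? i | trans (sym (lookup∘tabulate (does ∘ P?) i)) ([]=⇒lookup i∈)
... | yes Pi | _  = Pi
... | no  _  | ()

∉⇒lookup : ∀ {p : Subset k} {i} → i ∉ p → lookup p i ≡ false
∉⇒lookup {p = p} {i} i∉p with lookup p i in eq
... | true  = contradiction (lookup⇒[]= i p eq) i∉p
... | false = refl

x∈p─q⇒x∉q : ∀ (p q : Subset k) {x} → x ∈ p ─ q → x ∉ q
x∈p─q⇒x∉q (_ Vec.∷ p) (inside Vec.∷ q) () here
x∈p─q⇒x∉q (_ Vec.∷ p) (_ Vec.∷ q) (there x∈p─q) (there x∈q) = x∈p─q⇒x∉q p q x∈p─q x∈q

x∈p-y⇒x≢y : ∀ (p : Subset k) {x y} → x ∈ p - y → x ≢ y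
x∈p-y⇒x≢y p {x} x∈ refl = x∈p─q⇒x∉q p ⁅ x ⁆ x∈ (x∈⁅x⁆ x)

x∉p-y⇒x≡y⊎x∉p : ∀ {p : Subset k} {x} y → x ∉ p - y → x ≡ y ⊎ x ∉ p
x∉p-y⇒x≡y⊎x∉p {x = x} y x∉ with x ≟ y
... | yes x≡y = inj₁ x≡y
... | no  x≢y = inj₂ λ x∈p → x∉ (x∈p∧x≢y⇒x∈p-y x∈p x≢y)

-- For the amortisation of a pop: what remains unmoved and what belongs to the popped vertex are
-- disjoint parts of what was unmoved before.
∣p∣+∣q∣≤∣r∣ : ∀ (p q r : Subset k) → p ⊆ r → q ⊆ r → (∀ {x} → x ∈ p → x ∉ q) →
             ∣ p ∣ + ∣ q ∣ ≤ ∣ r ∣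
∣p∣+∣q∣≤∣r∣ Vec.[] Vec.[] Vec.[] _ _ _ = z≤n
∣p∣+∣q∣≤∣r∣ (outside Vec.∷ p) (outside Vec.∷ q) (x Vec.∷ r) p⊆r q⊆r d =
  ℕ.≤-trans (∣p∣+∣q∣≤∣r∣ p q r (drop-∷-⊆ p⊆r) (drop-∷-⊆ q⊆r) (λ i∈p i∈q → d (there i∈p) (there i∈q)))
            (∣p∣≤∣x∷p∣ x r)
∣p∣+∣q∣≤∣r∣ (inside Vec.∷ p) (inside Vec.∷ q) _ _ _ d = contradiction here (d here)
∣p∣+∣q∣≤∣r∣ (inside Vec.∷ p) (outside Vec.∷ q) (inside Vec.∷ r) p⊆r q⊆r d =
  s≤s (∣p∣+∣q∣≤∣r∣ p q r (drop-∷-⊆ p⊆r) (drop-∷-⊆ q⊆r) (λ i∈p i∈q → d (there i∈p) (there i∈q)))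
∣p∣+∣q∣≤∣r∣ (outside Vec.∷ p) (inside Vec.∷ q) (inside Vec.∷ r) p⊆r q⊆r d =
  ℕ.≤-trans (ℕ.≤-reflexive (ℕ.+-suc ∣ p ∣ ∣ q ∣))
  (s≤s (∣p∣+∣q∣≤∣r∣ p q r (drop-∷-⊆ p⊆r) (drop-∷-⊆ q⊆r) (λ i∈p i∈q → d (there i∈p) (there i∈q))))
∣p∣+∣q∣≤∣r∣ (inside Vec.∷ p) (outside Vec.∷ q) (outside Vec.∷ r) p⊆r _ _ with () ← p⊆r here
∣p∣+∣q∣≤∣r∣ (outside Vec.∷ p) (inside Vec.∷ q) (outside Vec.∷ r) _ q⊆r _ with () ← q⊆r here

argmax : (p : Subset k) (f : Fin k → ℤ) →
         Empty p ⊎ ∃ λ i → i ∈ p × (∀ j → j ∈ p → f j ℤ.≤ f i)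
argmax Vec.[] f = inj₁ λ ()
argmax (outside Vec.∷ p) f with argmax p (f ∘ suc)
... | inj₁ empty           = inj₁ λ { (suc i , there i∈p) → empty (i , i∈p) }
... | inj₂ (i , i∈p , max) = inj₂ (suc i , there i∈p , λ { (suc j) (there j∈p) → max j j∈p })
argmax (inside Vec.∷ p) f with argmax p (f ∘ suc)
... | inj₁ empty = inj₂ (zero , here , λ
  { zero _ → ℤ.≤-refl ; (suc j) (there j∈p) → contradiction (j , j∈p) empty })
... | inj₂ (i , i∈p , max) with f zero ℤ.≤? f (suc i)
...   | yes ≤ = inj₂ (suc i , there i∈p , λ { zero _ → ≤ ; (suc j) (there j∈p) → max j j∈p })
...   | no  ≰ = inj₂ (zero , here , λ
  { zero _ → ℤ.≤-refl ; (suc j) (there j∈p) → ℤ.≤-trans (max j j∈p) (ℤ.<⇒≤ (ℤ.≰⇒> ≰)) })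

-- Indicators and sums

𝟙 : Bool → ℤ
𝟙 true  = 1ℤ
𝟙 false = 0ℤ

𝟙-∧ : ∀ x y → 𝟙 (x ∧ y) ≡ 𝟙 x ℤ.* 𝟙 y
𝟙-∧ true  y = sym (ℤ.*-identityˡ (𝟙 y))
𝟙-∧ false y = refl

[_∈_]? : Fin k → Subset k → ℤ
[ i ∈ p ]? = 𝟙 (lookup p i)

∈⇒1 : ∀ {p : Subset k} {i} → i ∈ p → [ i ∈ p ]? ≡ 1ℤ
∈⇒1 i∈p = cong 𝟙 ([]=⇒lookup i∈p)

∉⇒0 : ∀ {p : Subset k} {i} → i ∉ p → [ i ∈ p ]? ≡ 0ℤ
∉⇒0 i∉p = cong 𝟙 (∉⇒lookup i∉p)

[∈]-cong : ∀ (p q : Subset k) {i} → (i ∈ p → i ∈ q) → (i ∈ q → i ∈ p) → [ i ∈ p ]? ≡ [ i ∈ q ]?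
[∈]-cong p q {i} f g with i ∈? p
... | yes i∈p = trans (∈⇒1 i∈p) (sym (∈⇒1 (f i∈p)))
... | no  i∉p = trans (∉⇒0 i∉p) (sym (∉⇒0 (i∉p ∘ g)))

δ : Fin k → Fin k → ℤ
δ i j = 𝟙 (does (i ≟ j))

δ-diag : ∀ (i : Fin k) → δ i i ≡ 1ℤ
δ-diag i = cong 𝟙 (dec-true (i ≟ i) refl)

δ-off : ∀ {i j : Fin k} → i ≢ j → δ i j ≡ 0ℤ
δ-off {i = i} {j} i≢j = cong 𝟙 (dec-false (i ≟ j) i≢j)

∣p∣≡∑ : ∀ (p : Subset k) → + ∣ p ∣ ≡ sum (λ i → [ i ∈ p ]?)
∣p∣≡∑ Vec.[]          = refl
∣p∣≡∑ (inside  Vec.∷ p) = cong (ℤ._+_ 1ℤ) (∣p∣≡∑ p)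
∣p∣≡∑ (outside Vec.∷ p) = trans (∣p∣≡∑ p) (sym (ℤ.+-identityˡ _))

sum-change : ∀ (f g : Fin k → ℤ) i → (∀ j → j ≢ i → f j ≡ g j) →
             sum f ≡ sum g ℤ.+ (f i ℤ.- g i)
sum-change f g zero eq = begin
  f zero ℤ.+ sum (f ∘ suc) ≡⟨ cong (ℤ._+_ (f zero)) (sum-cong-≗ (λ j → eq (suc j) λ ())) ⟩
  f zero ℤ.+ sum (g ∘ suc) ≡⟨ lemma (f zero) (g zero) _ ⟩
  sum g ℤ.+ (f zero ℤ.- g zero) ∎
  where
  open ≡-Reasoning
  lemma : ∀ x y z → x ℤ.+ z ≡ y ℤ.+ z ℤ.+ (x ℤ.- y)
  lemma x y z = solve (x ∷ y ∷ z ∷ [])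
sum-change f g (suc i) eq = begin
  f zero ℤ.+ sum (f ∘ suc)
    ≡⟨ cong₂ ℤ._+_ (eq zero λ ()) (sum-change (f ∘ suc) (g ∘ suc) i λ j j≢i → eq (suc j) λ { refl → j≢i refl }) ⟩
  g zero ℤ.+ (sum (g ∘ suc) ℤ.+ (f (suc i) ℤ.- g (suc i)))
    ≡⟨ ℤ.+-assoc (g zero) _ _ ⟨
  sum g ℤ.+ (f (suc i) ℤ.- g (suc i)) ∎
  where open ≡-Reasoning

sum-δ : ∀ (f : Fin k → ℤ) i → sum (λ j → δ i j ℤ.* f j) ≡ f i
sum-δ {k} f i = begin
  sum (λ j → δ i j ℤ.* f j)
    ≡⟨ sum-change _ (const 0ℤ) i (λ j j≢i → trans (cong (ℤ._* f j) (δ-off (j≢i ∘ sym))) (ℤ.*-zeroˡ (f j))) ⟩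
  sum {k} (const 0ℤ) ℤ.+ (δ i i ℤ.* f i ℤ.- 0ℤ)
    ≡⟨ cong₂ (λ x y → x ℤ.+ (y ℤ.* f i ℤ.- 0ℤ)) (sum-replicate-zero k) (δ-diag i) ⟩
  0ℤ ℤ.+ (1ℤ ℤ.* f i ℤ.- 0ℤ) ≡⟨ lemma (f i) ⟩
  f i ∎
  where
  open ≡-Reasoning
  lemma : ∀ x → 0ℤ ℤ.+ (1ℤ ℤ.* x ℤ.- 0ℤ) ≡ x
  lemma x = solve (x ∷ [])

-- Balance and agony

symDiff : Subset k → Subset k → Subset k
symDiff p q = (p ─ q) ∪ (q ─ p)

∈-symDiff⁻ : ∀ (p q : Subset k) {i} → i ∈ symDiff p q → (i ∈ p × i ∉ q) ⊎ (i ∉ p × i ∈ q)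
∈-symDiff⁻ p q {i} i∈ with x∈p∪q⁻ (p ─ q) (q ─ p) i∈
... | inj₁ i∈p─q = inj₁ (p─q⊆p p q i∈p─q , x∈p─q⇒x∉q p q i∈p─q)
... | inj₂ i∈q─p = inj₂ (x∈p─q⇒x∉q q p i∈q─p , p─q⊆p q p i∈q─p)

∈-symDiffˡ : ∀ {p q : Subset k} {i} → i ∈ p → i ∉ q → i ∈ symDiff p q
∈-symDiffˡ i∈p i∉q = x∈p∪q⁺ (inj₁ (x∈p∧x∉q⇒x∈p─q i∈p i∉q))

∈-symDiffʳ : ∀ {p q : Subset k} {i} → i ∉ p → i ∈ q → i ∈ symDiff p q
∈-symDiffʳ i∉p i∈q = x∈p∪q⁺ (inj₂ (x∈p∧x∉q⇒x∈p─q i∈q i∉p))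

∉-symDiff-both : ∀ {p q : Subset k} {i} → i ∈ p → i ∈ q → i ∉ symDiff p q
∉-symDiff-both {p = p} {q} i∈p i∈q i∈ with ∈-symDiff⁻ p q i∈
... | inj₁ (_ , i∉q) = i∉q i∈q
... | inj₂ (i∉p , _) = i∉p i∈p

module _ (G : Graph) where
  open Graph G

  -- `Eulerian` compares two cardinalities. A signed balance also describes the sets met along the
  -- parent path, which have a unit surplus at one vertex and a unit deficit at another.
  flow : Fin m → Fin n → ℤ
  flow e v = δ (src e) v ℤ.- δ (tgt e) v

  balance : Subset m → Fin n → ℤ
  balance F v = sum λ e → [ e ∈ F ]? ℤ.* flow e v

  Balanced : Subset m → Set
  Balanced F = ∀ v → balance F v ≡ 0ℤ

  degree-sum : ∀ (f : Fin m → Fin n) F v →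
               + ∣ F ∩ tabulate (λ e → does (f e ≟ v)) ∣ ≡ sum (λ e → [ e ∈ F ]? ℤ.* δ (f e) v)
  degree-sum f F v = trans (∣p∣≡∑ (F ∩ p)) (sum-cong-≗ λ e → begin
    𝟙 (lookup (F ∩ p) e)                ≡⟨ cong 𝟙 (lookup-zipWith _∧_ e F p) ⟩
    𝟙 (lookup F e ∧ lookup p e)         ≡⟨ 𝟙-∧ (lookup F e) (lookup p e) ⟩
    [ e ∈ F ]? ℤ.* 𝟙 (lookup p e)
      ≡⟨ cong (λ b → [ e ∈ F ]? ℤ.* 𝟙 b) (lookup∘tabulate (λ e → does (f e ≟ v)) e) ⟩
    [ e ∈ F ]? ℤ.* δ (f e) v            ∎)
    where
    open ≡-Reasoning
    p = tabulate (λ e → does (f e ≟ v))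

  balance+in≡out : ∀ F v → balance F v ℤ.+ + ∣ F ∩ inEdges G v ∣ ≡ + ∣ F ∩ outEdges G v ∣
  balance+in≡out F v = begin
    balance F v ℤ.+ + ∣ F ∩ inEdges G v ∣
      ≡⟨ cong (ℤ._+_ (balance F v)) (degree-sum tgt F v) ⟩
    balance F v ℤ.+ sum (λ e → [ e ∈ F ]? ℤ.* δ (tgt e) v)
      ≡⟨ ∑-distrib-+ (λ e → [ e ∈ F ]? ℤ.* flow e v) (λ e → [ e ∈ F ]? ℤ.* δ (tgt e) v) ⟨
    sum (λ e → [ e ∈ F ]? ℤ.* flow e v ℤ.+ [ e ∈ F ]? ℤ.* δ (tgt e) v)
      ≡⟨ sum-cong-≗ (λ e → lemma [ e ∈ F ]? (δ (src e) v) (δ (tgt e) v)) ⟩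
    sum (λ e → [ e ∈ F ]? ℤ.* δ (src e) v)
      ≡⟨ degree-sum src F v ⟨
    + ∣ F ∩ outEdges G v ∣ ∎
    where
    open ≡-Reasoning
    lemma : ∀ a b c → a ℤ.* (b ℤ.- c) ℤ.+ a ℤ.* c ≡ a ℤ.* b
    lemma a b c = solve (a ∷ b ∷ c ∷ [])

  eulerian⇒balanced : ∀ F → Eulerian G F → Balanced F
  eulerian⇒balanced F eu v = begin
    balance F v                        ≡⟨ lemma (balance F v) d ⟩
    balance F v ℤ.+ d ℤ.- d            ≡⟨ cong (ℤ._- d) (balance+in≡out F v) ⟩
    + ∣ F ∩ outEdges G v ∣ ℤ.- d       ≡⟨ cong (λ x → + x ℤ.- d) (eu v) ⟨
    d ℤ.- d                            ≡⟨ ℤ.i≡j⇒i-j≡0 {d} refl ⟩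
    0ℤ ∎
    where
    open ≡-Reasoning
    d = + ∣ F ∩ inEdges G v ∣
    lemma : ∀ x y → x ≡ x ℤ.+ y ℤ.- y
    lemma x y = solve (x ∷ y ∷ [])

  balanced⇒eulerian : ∀ F → Balanced F → Eulerian G F
  balanced⇒eulerian F b v = ℤ.+-injective (begin
    + ∣ F ∩ inEdges G v ∣                 ≡⟨ ℤ.+-identityˡ _ ⟨
    0ℤ ℤ.+ + ∣ F ∩ inEdges G v ∣          ≡⟨ cong (λ x → x ℤ.+ + ∣ F ∩ inEdges G v ∣) (b v) ⟨
    balance F v ℤ.+ + ∣ F ∩ inEdges G v ∣ ≡⟨ balance+in≡out F v ⟩
    + ∣ F ∩ outEdges G v ∣                ∎)
    where open ≡-Reasoning

  balance-change : ∀ F F′ e v → (∀ f → f ≢ e → (f ∈ F → f ∈ F′) × (f ∈ F′ → f ∈ F)) →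
                   balance F′ v ≡ balance F v ℤ.+ ([ e ∈ F′ ]? ℤ.- [ e ∈ F ]?) ℤ.* flow e v
  balance-change F F′ e v same = trans
    (sum-change _ (λ f → [ f ∈ F ]? ℤ.* flow f v) e
      (λ f f≢e → cong (ℤ._* flow f v) ([∈]-cong F′ F (proj₂ (same f f≢e)) (proj₁ (same f f≢e)))))
    (cong (ℤ._+_ (balance F v)) (lemma [ e ∈ F′ ]? [ e ∈ F ]? (flow e v)))
    where
    lemma : ∀ a b c → a ℤ.* c ℤ.- b ℤ.* c ≡ (a ℤ.- b) ℤ.* c
    lemma a b c = solve (a ∷ b ∷ c ∷ [])

  balance-remove : ∀ F e v → e ∈ F → balance (F - e) v ≡ balance F v ℤ.- flow e v
  balance-remove F e v e∈F = begin
    balance (F - e) v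
      ≡⟨ balance-change F (F - e) e v (λ f f≢e → (λ f∈F → x∈p∧x≢y⇒x∈p-y f∈F f≢e) , p─q⊆p F ⁅ e ⁆) ⟩
    balance F v ℤ.+ ([ e ∈ F - e ]? ℤ.- [ e ∈ F ]?) ℤ.* flow e v
      ≡⟨ cong₂ (λ x y → balance F v ℤ.+ (x ℤ.- y) ℤ.* flow e v)
               (∉⇒0 (λ e∈ → x∈p-y⇒x≢y F e∈ refl)) (∈⇒1 e∈F) ⟩
    balance F v ℤ.+ (0ℤ ℤ.- 1ℤ) ℤ.* flow e v
      ≡⟨ lemma (balance F v) (flow e v) ⟩
    balance F v ℤ.- flow e v ∎
    where
    open ≡-Reasoning
    lemma : ∀ x y → x ℤ.+ (0ℤ ℤ.- 1ℤ) ℤ.* y ≡ x ℤ.- y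
    lemma x y = solve (x ∷ y ∷ [])

  module _ (F O : Subset m) (e : Fin m) (v : Fin n) (e∉O : e ∉ O) where
    private
      e∈O⁺ : e ∈ O ∪ ⁅ e ⁆
      e∈O⁺ = x∈p∪q⁺ (inj₂ (x∈⁅x⁆ e))

      shrink : ∀ {f} → f ≢ e → f ∈ O ∪ ⁅ e ⁆ → f ∈ O
      shrink f≢e f∈ = [ id , (λ f∈⁅e⁆ → contradiction (x∈⁅y⁆⇒x≡y e f∈⁅e⁆) f≢e) ] (x∈p∪q⁻ O ⁅ e ⁆ f∈)

      grow : ∀ {f} → f ∈ O → f ∈ O ∪ ⁅ e ⁆
      grow f∈O = x∈p∪q⁺ (inj₁ f∈O)

      same : ∀ f → f ≢ e →
             (f ∈ symDiff F O → f ∈ symDiff F (O ∪ ⁅ e ⁆)) × (f ∈ symDiff F (O ∪ ⁅ e ⁆) → f ∈ symDiff F O)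
      same f f≢e = to , from
        where
        to : f ∈ symDiff F O → f ∈ symDiff F (O ∪ ⁅ e ⁆)
        to f∈ with ∈-symDiff⁻ F O f∈
        ... | inj₁ (f∈F , f∉O) = ∈-symDiffˡ f∈F (f∉O ∘ shrink f≢e)
        ... | inj₂ (f∉F , f∈O) = ∈-symDiffʳ f∉F (grow f∈O)
        from : f ∈ symDiff F (O ∪ ⁅ e ⁆) → f ∈ symDiff F O
        from f∈ with ∈-symDiff⁻ F (O ∪ ⁅ e ⁆) f∈
        ... | inj₁ (f∈F , f∉O) = ∈-symDiffˡ f∈F (f∉O ∘ grow)
        ... | inj₂ (f∉F , f∈O) = ∈-symDiffʳ f∉F (shrink f≢e f∈O)

    balance-flip-∉ : e ∉ F → balance (symDiff F (O ∪ ⁅ e ⁆)) v ≡ balance (symDiff F O) v ℤ.+ flow e v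
    balance-flip-∉ e∉F = trans (balance-change (symDiff F O) (symDiff F (O ∪ ⁅ e ⁆)) e v same)
      (trans (cong₂ (λ x y → balance (symDiff F O) v ℤ.+ (x ℤ.- y) ℤ.* flow e v)
               (∈⇒1 (∈-symDiffʳ e∉F e∈O⁺)) (∉⇒0 {p = symDiff F O} e∉))
             (lemma (balance (symDiff F O) v) (flow e v)))
      where
      e∉ : e ∉ symDiff F O
      e∉ e∈ = [ e∉F ∘ proj₁ , e∉O ∘ proj₂ ] (∈-symDiff⁻ F O e∈)
      lemma : ∀ x y → x ℤ.+ (1ℤ ℤ.- 0ℤ) ℤ.* y ≡ x ℤ.+ y
      lemma x y = solve (x ∷ y ∷ [])

    balance-flip-∈ : e ∈ F → balance (symDiff F (O ∪ ⁅ e ⁆)) v ≡ balance (symDiff F O) v ℤ.- flow e v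
    balance-flip-∈ e∈F = trans (balance-change (symDiff F O) (symDiff F (O ∪ ⁅ e ⁆)) e v same)
      (trans (cong₂ (λ x y → balance (symDiff F O) v ℤ.+ (x ℤ.- y) ℤ.* flow e v)
               (∉⇒0 {p = symDiff F (O ∪ ⁅ e ⁆)} (∉-symDiff-both e∈F e∈O⁺)) (∈⇒1 (∈-symDiffˡ e∈F e∉O)))
             (lemma (balance (symDiff F O) v) (flow e v)))
      where
      lemma : ∀ x y → x ℤ.+ (0ℤ ℤ.- 1ℤ) ℤ.* y ≡ x ℤ.- y
      lemma x y = solve (x ∷ y ∷ [])

  -- Summation by parts: the rank drop along an edge becomes a pairing of its flow with `r`, so that
  -- sums over edges can be regrouped by vertices.
  rank-difference : ∀ (r : Rank G) e → r (src e) ℤ.- r (tgt e) ≡ sum (λ v → flow e v ℤ.* r v)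
  rank-difference r e = begin
    r (src e) ℤ.- r (tgt e)
      ≡⟨ cong₂ ℤ._-_ (sum-δ r (src e)) (sum-δ r (tgt e)) ⟨
    A ℤ.- B
      ≡⟨ cong (ℤ._- B) A≡ ⟩
    sum (λ v → flow e v ℤ.* r v) ℤ.+ B ℤ.- B
      ≡⟨ cancel (sum (λ v → flow e v ℤ.* r v)) B ⟩
    sum (λ v → flow e v ℤ.* r v) ∎
    where
    open ≡-Reasoning
    A = sum (λ v → δ (src e) v ℤ.* r v)
    B = sum (λ v → δ (tgt e) v ℤ.* r v)
    lemma : ∀ a b c → a ℤ.* c ≡ (a ℤ.- b) ℤ.* c ℤ.+ b ℤ.* c
    lemma a b c = solve (a ∷ b ∷ c ∷ [])
    cancel : ∀ a b → a ℤ.+ b ℤ.- b ≡ a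
    cancel a b = solve (a ∷ b ∷ [])
    A≡ : A ≡ sum (λ v → flow e v ℤ.* r v) ℤ.+ B
    A≡ = trans (sum-cong-≗ (λ v → lemma (δ (src e) v) (δ (tgt e) v) (r v)))
               (∑-distrib-+ (λ v → flow e v ℤ.* r v) (λ v → δ (tgt e) v ℤ.* r v))

  -- Exchanging the sums collects `r v` times the balance of `v` at each vertex. This takes the
  -- place of a decomposition into cycles.
  balanced⇒∑≡0 : ∀ (r : Rank G) F → Balanced F →
                 sum (λ e → [ e ∈ F ]? ℤ.* (r (src e) ℤ.- r (tgt e))) ≡ 0ℤ
  balanced⇒∑≡0 r F b = begin
    sum (λ e → [ e ∈ F ]? ℤ.* (r (src e) ℤ.- r (tgt e)))
      ≡⟨ sum-cong-≗ (λ e → trans (cong (ℤ._*_ [ e ∈ F ]?) (rank-difference r e))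
                                 (*-distribˡ-sum [ e ∈ F ]? (λ v → flow e v ℤ.* r v))) ⟩
    sum (λ e → sum λ v → [ e ∈ F ]? ℤ.* (flow e v ℤ.* r v))
      ≡⟨ ∑-comm (λ e v → [ e ∈ F ]? ℤ.* (flow e v ℤ.* r v)) ⟩
    sum (λ v → sum λ e → [ e ∈ F ]? ℤ.* (flow e v ℤ.* r v))
      ≡⟨ sum-cong-≗ (λ v → trans (sum-cong-≗ (λ e → lemma [ e ∈ F ]? (flow e v) (r v)))
                            (trans (sym (*-distribˡ-sum (r v) (λ e → [ e ∈ F ]? ℤ.* flow e v)))
                              (trans (cong (ℤ._*_ (r v)) (b v)) (ℤ.*-zeroʳ (r v))))) ⟩
    sum {n} (const 0ℤ)
      ≡⟨ sum-replicate-zero n ⟩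
    0ℤ ∎
    where
    open ≡-Reasoning
    lemma : ∀ a b c → a ℤ.* (b ℤ.* c) ≡ c ℤ.* (a ℤ.* b)
    lemma a b c = solve (a ∷ b ∷ c ∷ [])

  -- Edges outside `F` are forward and contribute 0. Inside `F`, zero slack makes the truncation in
  -- the agony inactive, which leaves the rank drop plus 1, and the drops cancel.
  tight⇒agony≡size : ∀ {F r} → Eulerian G F → Conforms G r F →
                     (∀ e → e ∈ F → slack G e r ℤ.≤ 0ℤ) → agony G r ≡ + ∣ F ∣
  tight⇒agony≡size {F} {r} eu conf tight = begin
    sum (λ e → edgeAgony G e r)
      ≡⟨ sum-cong-≗ edge ⟩
    sum (λ e → [ e ∈ F ]? ℤ.* (r (src e) ℤ.- r (tgt e)) ℤ.+ [ e ∈ F ]?)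
      ≡⟨ ∑-distrib-+ (λ e → [ e ∈ F ]? ℤ.* (r (src e) ℤ.- r (tgt e))) (λ e → [ e ∈ F ]?) ⟩
    sum (λ e → [ e ∈ F ]? ℤ.* (r (src e) ℤ.- r (tgt e))) ℤ.+ sum (λ e → [ e ∈ F ]?)
      ≡⟨ cong₂ ℤ._+_ (balanced⇒∑≡0 r F (eulerian⇒balanced F eu)) (sym (∣p∣≡∑ F)) ⟩
    0ℤ ℤ.+ + ∣ F ∣
      ≡⟨ ℤ.+-identityˡ _ ⟩
    + ∣ F ∣ ∎
    where
    open ≡-Reasoning
    in-agony : ∀ a b → b ℤ.- a ℤ.- 1ℤ ℤ.≤ 0ℤ → (a ℤ.- b ℤ.+ 1ℤ) ℤ.⊔ 0ℤ ≡ 1ℤ ℤ.* (a ℤ.- b) ℤ.+ 1ℤ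
    in-agony a b h = trans (ℤ.i≥j⇒i⊔j≡i (close (gap h) (solve (a ∷ b ∷ [])))) (solve (a ∷ b ∷ []))
    out-agony : ∀ a b → a ℤ.< b → (a ℤ.- b ℤ.+ 1ℤ) ℤ.⊔ 0ℤ ≡ 0ℤ ℤ.* (a ℤ.- b) ℤ.+ 0ℤ
    out-agony a b h = trans (ℤ.i≤j⇒i⊔j≡j (close (gap< h) (solve (a ∷ b ∷ [])))) (solve (a ∷ b ∷ []))
    edge : ∀ e → edgeAgony G e r ≡ [ e ∈ F ]? ℤ.* (r (src e) ℤ.- r (tgt e)) ℤ.+ [ e ∈ F ]?
    edge e with e ∈? F
    ... | yes e∈F = trans (in-agony (r (src e)) (r (tgt e))
                            (ℤ.≤-trans (excess-lower (r (src e)) (r (tgt e))) (tight e e∈F)))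
                      (cong (λ x → x ℤ.* (r (src e) ℤ.- r (tgt e)) ℤ.+ x) (sym (∈⇒1 e∈F)))
    ... | no e∉F  = trans (out-agony (r (src e)) (r (tgt e)) (ℤ.≰⇒> λ back → e∉F (conf e back)))
                      (cong (λ x → x ℤ.* (r (src e) ℤ.- r (tgt e)) ℤ.+ x) (sym (∉⇒0 e∉F)))

-- The invariant of Relief

module _ (G : Graph) where
  open Graph G
  open State

  -- The invariant of the outer loop. The slack bound is carried along because it caps the capacity
  -- of every later call, not only of the first.
  record Feasible (H : Subset m) (r : Rank G) : Set where
    field
      eulerian : Eulerian G H
      conforms : Conforms G r H
      bounded  : ∀ e → e ∈ H → slack G e r ℤ.≤ + m

    outside-forward : ∀ {e} → e ∉ H → r (src e) ℤ.< r (tgt e)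
    outside-forward {e} e∉H = ℤ.≰⇒> λ back → e∉H (conforms e back)

  module Relief (κ : Call G) where
    open Call κ

    record Ready (H : Subset m) : Set where
      field
        feasible : Feasible H r
        ps∈H     : ps ∈ H
        slack>0  : 0ℤ ℤ.< slack G ps r
      open Feasible feasible public

      slack≡capacity : slack G ps r ≡ capacity
      slack≡capacity = excess-pos (r p) (r s) ℤ.≤-refl slack>0

      capacity>0 : 0ℤ ℤ.< capacity
      capacity>0 = subst (0ℤ ℤ.<_) slack≡capacity slack>0

      capacity≤m : capacity ℤ.≤ + m
      capacity≤m = subst (ℤ._≤ + m) slack≡capacity (bounded ps ps∈H)

    -- The rank that v has when S is empty, unless t v is increased before.
    R : State G → Rank G
    R σ v = r v ℤ.+ t σ v

    -- `high` records the order of the pops: a vertex popped earlier has been raised at least as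
    -- much as the one popped now. This is what prevents a second insertion.
    record Popped (σ : State G) (v : Fin n) : Set where
      field
        left    : v ∉ S σ
        settled : r′ σ v ≡ R σ v
        raised  : 0ℤ ℤ.< t σ v
        high    : top σ ℤ.≤ t σ v
    open Popped

    data Status (σ : State G) (v : Fin n) : Set where
      untouched : v ∉ S σ → r′ σ v ≡ r v → t σ v ≡ 0ℤ → Status σ v
      queued    : v ∈ S σ → r′ σ v ≡ r v → 0ℤ ℤ.< t σ v → t σ v ℤ.≤ top σ → Status σ v
      finished  : Popped σ v → Status σ v

    -- e is the edge through which y became the parent of v, and a and b are the
    -- ranks with which y and v end.
    data Link (H : Subset m) (y : Fin n) (e : Fin m) (v : Fin n) (a b : ℤ) : Set where
      forward : e ∉ H → src e ≡ y → tgt e ≡ v → b ≡ a ℤ.+ 1ℤ → Link H y e v a b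
      reverse : e ∈ H → tgt e ≡ y → src e ≡ v → a ℤ.- b ℤ.- 1ℤ ≡ slack G e r → Link H y e v a b

    -- T₁ and T₂ are the out- and in-edges of the last popped vertex that have
    -- not been processed yet.
    record Inv (σ : State G) (T₁ T₂ : Subset m) : Set where
      field
        status     : ∀ v → Status σ v
        out-ok     : ∀ e → e ∉ F σ → Popped σ (src e) → e ∉ T₁ → R σ (src e) ℤ.< R σ (tgt e)
        in-ok      : ∀ e → e ∈ F σ → Popped σ (tgt e) → e ∉ T₂ → slack G e (R σ) ℤ.≤ slack G e r
        t-p        : t σ p ≡ capacity
        top-nonneg : 0ℤ ℤ.≤ top σ
        top-bound  : top σ ℤ.≤ capacity
        depth      : Fin n → ℕ
        tree       : ∀ v → v ≢ p → 0ℤ ℤ.< t σ v → ∃₂ λ y e →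
                     parent σ v ≡ just (y , e) × Popped σ y × depth y < depth v ×
                     Link (F σ) y e v (R σ y) (R σ v)

      t-nonneg : ∀ v → 0ℤ ℤ.≤ t σ v
      t-nonneg v with status v
      ... | untouched _ _ t≡0  = ℤ.≤-reflexive (sym t≡0)
      ... | queued _ _ 0<t _   = ℤ.<⇒≤ 0<t
      ... | finished P         = ℤ.<⇒≤ (raised P)

      r≤R : ∀ v → r v ℤ.≤ R σ v
      r≤R v = subst (ℤ._≤ R σ v) (ℤ.+-identityʳ (r v)) (ℤ.+-monoʳ-≤ (r v) (t-nonneg v))

      popped? : ∀ v → Dec (Popped σ v)
      popped? v with status v
      ... | untouched _ _ t≡0 = no λ P → ℤ.<-irrefl (sym t≡0) (raised P)
      ... | queued v∈S _ _ _  = no λ P → left P v∈S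
      ... | finished P        = yes P

      unmoved : ∀ {v} → ¬ Popped σ v → r′ σ v ≡ r v
      unmoved {v} ¬P with status v
      ... | untouched _ eq _ = eq
      ... | queued _ eq _ _  = eq
      ... | finished P       = contradiction P ¬P

      queued-rank : ∀ {v} → v ∈ S σ → r′ σ v ≡ r v
      queued-rank v∈S = unmoved λ P → left P v∈S

      queued-raised : ∀ {v} → v ∈ S σ → 0ℤ ℤ.< t σ v
      queued-raised {v} v∈S with status v
      ... | untouched v∉S _ _ = contradiction v∈S v∉S
      ... | queued _ _ 0<t _  = 0<t
      ... | finished P        = contradiction v∈S (left P)

      queued-bound : ∀ {v} → v ∈ S σ → t σ v ℤ.≤ top σ
      queued-bound {v} v∈S with status v
      ... | untouched v∉S _ _  = contradiction v∈S v∉S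
      ... | queued _ _ _ t≤top = t≤top
      ... | finished P         = contradiction v∈S (left P)

    open Inv

    -- Preservation of the invariant by the moves of Relief

    processed : ∀ {σ T₁ T₂ T₁′ T₂′} →
      (∀ e → e ∉ F σ → Popped σ (src e) → e ∉ T₁′ → e ∉ T₁ ⊎ R σ (src e) ℤ.< R σ (tgt e)) →
      (∀ e → e ∈ F σ → Popped σ (tgt e) → e ∉ T₂′ → e ∉ T₂ ⊎ slack G e (R σ) ℤ.≤ slack G e r) →
      Inv σ T₁ T₂ → Inv σ T₁′ T₂′
    processed h₁ h₂ inv = record
      { status = status inv ; t-p = t-p inv ; top-nonneg = top-nonneg inv
      ; top-bound = top-bound inv ; depth = depth inv ; tree = tree inv
      ; out-ok = λ e e∉F P e∉T → [ out-ok inv e e∉F P , id ]′ (h₁ e e∉F P e∉T)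
      ; in-ok  = λ e e∈F P e∉T → [ in-ok inv e e∈F P , id ]′ (h₂ e e∈F P e∉T)
      }

    processed-out : ∀ {σ T₁ T₂} e → (e ∉ F σ → R σ (src e) ℤ.< R σ (tgt e)) →
                    Inv σ T₁ T₂ → Inv σ (T₁ - e) T₂
    processed-out e ok = processed
      (λ f f∉F _ f∉T → [ (λ { refl → inj₂ (ok f∉F) }) , inj₁ ]′ (x∉p-y⇒x≡y⊎x∉p e f∉T))
      (λ _ _ _ → inj₁)

    processed-in : ∀ {σ T₁ T₂} e → (e ∈ F σ → slack G e (R σ) ℤ.≤ slack G e r) →
                   Inv σ T₁ T₂ → Inv σ T₁ (T₂ - e)
    processed-in e ok = processed
      (λ _ _ _ → inj₁)
      (λ f f∈F _ f∉T → [ (λ { refl → inj₂ (ok f∈F) }) , inj₁ ]′ (x∉p-y⇒x≡y⊎x∉p e f∉T))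

    initial-inv : ∀ {H} → Ready H → Inv (initial G κ H) ⊥ ⊥
    initial-inv {H} ready = record
      { status     = status₀
      ; out-ok     = λ e _ P _ → contradiction P (none (src e))
      ; in-ok      = λ e _ P _ → contradiction P (none (tgt e))
      ; t-p        = updateAt-updates p (const 0ℤ)
      ; top-nonneg = ℤ.<⇒≤ (Ready.capacity>0 ready)
      ; top-bound  = ℤ.≤-refl
      ; depth      = const 0
      ; tree       = λ v v≢p 0<t → contradiction (subst (0ℤ ℤ.<_) (t₀ v≢p) 0<t) (ℤ.<-irrefl refl)
      }
      where
      σ₀ = initial G κ H
      t₀ : ∀ {v} → v ≢ p → t σ₀ v ≡ 0ℤ
      t₀ {v} v≢p = updateAt-minimal v p (const 0ℤ) v≢p
      status₀ : ∀ v → Status σ₀ v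
      status₀ v with v ≟ p
      ... | yes refl = queued (x∈⁅x⁆ p) refl
                         (subst (0ℤ ℤ.<_) (sym (updateAt-updates p (const 0ℤ))) (Ready.capacity>0 ready))
                         (ℤ.≤-reflexive (updateAt-updates p (const 0ℤ)))
      ... | no v≢p   = untouched (v≢p ∘ x∈⁅y⁆⇒x≡y p) refl (t₀ v≢p)
      none : ∀ v → ¬ Popped σ₀ v
      none v P with v ≟ p
      ... | yes refl = left P (x∈⁅x⁆ p)
      ... | no v≢p   = ℤ.<-irrefl (sym (t₀ v≢p)) (raised P)

    -- A queued vertex has positive priority at most `top`, whence `1ℤ ≤ top`. This is returned as
    -- well because the potential uses the absolute value of `top`, which drops only while `top` is
    -- positive.
    descend-inv : ∀ {σ} → Inv σ ⊥ ⊥ → Nonempty (S σ) → (∀ v → v ∈ S σ → t σ v ≢ top σ) →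
                  1ℤ ℤ.≤ top σ × Inv (record σ { top = top σ ℤ.- 1ℤ }) ⊥ ⊥
    descend-inv {σ} inv (w , w∈S) none = 1≤top , record
      { status     = status′
      ; out-ok     = λ e e∉F P _ → out-ok inv e e∉F (popped⁻ P) ∉⊥
      ; in-ok      = λ e e∈F P _ → in-ok inv e e∈F (popped⁻ P) ∉⊥
      ; t-p        = t-p inv
      ; top-nonneg = gap 1≤top
      ; top-bound  = ℤ.≤-trans top-1≤top (top-bound inv)
      ; depth      = depth inv
      ; tree       = λ v v≢p 0<t → let y , e , eq , P , d , l = tree inv v v≢p 0<t in
                       y , e , eq , popped⁺ P , d , l
      }
      where
      below : ∀ {a b} → a ℤ.≤ b → a ≢ b → a ℤ.≤ b ℤ.- 1ℤ
      below {a} {b} a≤b a≢b = close (gap< (ℤ.≤∧≢⇒< a≤b a≢b)) (solve (a ∷ b ∷ []))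
      pred≤ : ∀ a → a ℤ.- 1ℤ ℤ.≤ a
      pred≤ a = close (gap {0ℤ} {1ℤ} (ℤ.+≤+ z≤n)) (solve (a ∷ []))
      top-1≤top : top σ ℤ.- 1ℤ ℤ.≤ top σ
      top-1≤top = pred≤ (top σ)
      1≤top : 1ℤ ℤ.≤ top σ
      1≤top = ℤ.≤-trans (ℤ.i<j⇒suc[i]≤j (queued-raised inv w∈S)) (queued-bound inv w∈S)
      popped⁺ : ∀ {v} → Popped σ v → Popped (record σ { top = top σ ℤ.- 1ℤ }) v
      popped⁺ P = record
        { left = left P ; settled = settled P ; raised = raised P ; high = ℤ.≤-trans top-1≤top (high P) }
      status′ : ∀ v → Status (record σ { top = top σ ℤ.- 1ℤ }) v
      status′ v with status inv v
      ... | untouched v∉S eq t≡0    = untouched v∉S eq t≡0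
      ... | queued v∈S eq 0<t t≤top = queued v∈S eq 0<t (below t≤top (none v v∈S))
      ... | finished P              = finished (popped⁺ P)
      -- `high` for the lowered pointer is too weak to give `high` for the old one. The status in
      -- `σ` supplies it: a vertex outside `S` with positive `t` can only be finished.
      popped⁻ : ∀ {v} → Popped (record σ { top = top σ ℤ.- 1ℤ }) v → Popped σ v
      popped⁻ {v} P with status inv v
      ... | untouched _ _ t≡0 = contradiction (raised P) (ℤ.<-irrefl (sym t≡0))
      ... | queued v∈S _ _ _  = contradiction v∈S (left P)
      ... | finished P′       = P′

    module Pop {σ u} (inv : Inv σ ⊥ ⊥) (u∈S : u ∈ S σ) (t≡top : t σ u ≡ top σ) where
      σ⁺ = popped G u σ

      other-rank : ∀ {v} → v ≢ u → r′ σ⁺ v ≡ r′ σ v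
      other-rank {v} = updateAt-minimal v u (r′ σ)

      new : Popped σ⁺ u
      new = record
        { left    = λ u∈ → x∈p-y⇒x≢y (S σ) u∈ refl
        ; settled = trans (updateAt-updates u (r′ σ)) (cong (ℤ._+ t σ u) (queued-rank inv u∈S))
        ; raised  = queued-raised inv u∈S
        ; high    = ℤ.≤-reflexive (sym t≡top)
        }

      popped-≢ : ∀ {v} → Popped σ v → v ≢ u
      popped-≢ P refl = left P u∈S

      popped⁺ : ∀ {v} → Popped σ v → Popped σ⁺ v
      popped⁺ P = record
        { left    = left P ∘ p─q⊆p (S σ) ⁅ u ⁆
        ; settled = trans (other-rank (popped-≢ P)) (settled P)
        ; raised  = raised P
        ; high    = high P
        }

      popped⁻ : ∀ {v} → Popped σ⁺ v → v ≢ u → Popped σ v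
      popped⁻ P v≢u = record
        { left    = λ v∈S → left P (x∈p∧x≢y⇒x∈p-y v∈S v≢u)
        ; settled = trans (sym (other-rank v≢u)) (settled P)
        ; raised  = raised P
        ; high    = high P
        }

      pop-inv : Inv σ⁺ (outEdges G u) (inEdges G u)
      pop-inv = record
        { status     = status⁺
        -- The new sets exempt exactly the edges whose popped end is `u`; for every other edge that
        -- end was popped earlier.
        ; out-ok     = λ e e∉F P e∉T → out-ok inv e e∉F
                         (popped⁻ P λ eq → e∉T (∈-tabulate⁺ (λ f → src f ≟ u) eq)) ∉⊥
        ; in-ok      = λ e e∈F P e∉T → in-ok inv e e∈F
                         (popped⁻ P λ eq → e∉T (∈-tabulate⁺ (λ f → tgt f ≟ u) eq)) ∉⊥
        ; t-p        = t-p inv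
        ; top-nonneg = top-nonneg inv
        ; top-bound  = top-bound inv
        ; depth      = depth inv
        ; tree       = λ v v≢p 0<t → let y , e , eq , P , d , l = tree inv v v≢p 0<t in
                         y , e , eq , popped⁺ P , d , l
        }
        where
        status⁺ : ∀ v → Status σ⁺ v
        status⁺ v with v ≟ u | status inv v
        ... | yes refl | _ = finished new
        ... | no v≢u | untouched v∉S eq t≡0 =
          untouched (v∉S ∘ p─q⊆p (S σ) ⁅ u ⁆) (trans (other-rank v≢u) eq) t≡0
        ... | no v≢u | queued v∈S eq 0<t t≤top =
          queued (x∈p∧x≢y⇒x∈p-y v∈S v≢u) (trans (other-rank v≢u) eq) 0<t t≤top
        ... | no v≢u | finished P = finished (popped⁺ P)

    -- The common part of both kinds of update. As `v` has not been popped, no link has `v` as its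
    -- parent, so changing the prospective rank and the depth of `v` affects only its own link.
    module Push {σ T₁ T₂} (inv : Inv σ T₁ T₂) {u v e inc}
                (Pu : Popped σ u) (¬Pv : ¬ Popped σ v)
                (0<inc : 0ℤ ℤ.< inc) (t<inc : t σ v ℤ.< inc) (inc≤top : inc ℤ.≤ top σ)
                (link : Link (F σ) u e v (R σ u) (r v ℤ.+ inc)) where
      σ⁺ = push G v inc u e σ

      t-new : t σ⁺ v ≡ inc
      t-new = updateAt-updates v (t σ)

      t-other : ∀ {w} → w ≢ v → t σ⁺ w ≡ t σ w
      t-other {w} = updateAt-minimal w v (t σ)

      R-other : ∀ {w} → w ≢ v → R σ⁺ w ≡ R σ w
      R-other {w} w≢v = cong (ℤ._+_ (r w)) (t-other w≢v)

      R-grows : ∀ w → R σ w ℤ.≤ R σ⁺ w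
      R-grows w with w ≟ v
      ... | yes refl = ℤ.+-monoʳ-≤ (r v) (ℤ.≤-trans (ℤ.<⇒≤ t<inc) (ℤ.≤-reflexive (sym t-new)))
      ... | no w≢v   = ℤ.≤-reflexive (sym (R-other w≢v))

      top-same : top σ⁺ ≡ top σ
      top-same = ℤ.i≥j⇒i⊔j≡i inc≤top

      popped-≢ : ∀ {w} → Popped σ w → w ≢ v
      popped-≢ P refl = ¬Pv P

      S-other : ∀ {w} → w ≢ v → w ∈ S σ⁺ → w ∈ S σ
      S-other w≢v w∈ = [ id , (λ w∈⁅v⁆ → contradiction (x∈⁅y⁆⇒x≡y v w∈⁅v⁆) w≢v) ]′ (x∈p∪q⁻ (S σ) ⁅ v ⁆ w∈)

      popped⁺ : ∀ {w} → Popped σ w → Popped σ⁺ w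
      popped⁺ P = record
        { left    = left P ∘ S-other (popped-≢ P)
        ; settled = trans (settled P) (sym (R-other (popped-≢ P)))
        ; raised  = subst (0ℤ ℤ.<_) (sym (t-other (popped-≢ P))) (raised P)
        ; high    = subst₂ ℤ._≤_ (sym top-same) (sym (t-other (popped-≢ P))) (high P)
        }

      popped⁻ : ∀ {w} → Popped σ⁺ w → Popped σ w
      popped⁻ P = record
        { left    = λ w∈S → left P (x∈p∪q⁺ (inj₁ w∈S))
        ; settled = trans (settled P) (R-other w≢v)
        ; raised  = subst (0ℤ ℤ.<_) (t-other w≢v) (raised P)
        ; high    = subst₂ ℤ._≤_ top-same (t-other w≢v) (high P)
        }
        where w≢v = λ { refl → left P (x∈p∪q⁺ (inj₂ (x∈⁅x⁆ v))) }

      -- An update needs a strict gain, but `p` already has the capacity, which bounds `top` and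
      -- hence the increment. So `p` never receives a parent and stays the root.
      v≢p : v ≢ p
      v≢p refl = ℤ.<-irrefl refl
        (ℤ.<-≤-trans t<inc (ℤ.≤-trans inc≤top
          (ℤ.≤-trans (top-bound inv) (ℤ.≤-reflexive (sym (t-p inv))))))

      -- A queued vertex may change its parent, and its depth is then overwritten. No inequality
      -- below it can break, since it is not yet the parent of anything.
      depth⁺ : Fin n → ℕ
      depth⁺ = updateAt (depth inv) v (const (suc (depth inv u)))

      depth-other : ∀ {w} → w ≢ v → depth⁺ w ≡ depth inv w
      depth-other {w} = updateAt-minimal w v (depth inv)

      push-inv : Inv σ⁺ T₁ T₂
      push-inv = record
        { status     = status⁺
        -- In both conditions the popped end is frozen while the other may rise: a rising head keeps
        -- a forward edge forward, and a rising tail can only lower a slack.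
        ; out-ok     = λ e e∉F P e∉T → subst (ℤ._< R σ⁺ (tgt e)) (sym (R-other (popped-≢ (popped⁻ P))))
                         (ℤ.<-≤-trans (out-ok inv e e∉F (popped⁻ P) e∉T) (R-grows (tgt e)))
        ; in-ok      = λ e e∈F P e∉T → subst (λ x → excess (R σ⁺ (src e)) x ℤ.≤ slack G e r)
                         (sym (R-other (popped-≢ (popped⁻ P))))
                         (ℤ.≤-trans (excess-antitoneˡ (R σ (src e)) (R σ⁺ (src e)) (R σ (tgt e)) (R-grows (src e)))
                                    (in-ok inv e e∈F (popped⁻ P) e∉T))
        ; t-p        = trans (t-other (v≢p ∘ sym)) (t-p inv)
        ; top-nonneg = subst (0ℤ ℤ.≤_) (sym top-same) (top-nonneg inv)
        ; top-bound  = subst (ℤ._≤ capacity) (sym top-same) (top-bound inv)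
        ; depth      = depth⁺
        ; tree       = tree⁺
        }
        where
        status⁺ : ∀ w → Status σ⁺ w
        status⁺ w with w ≟ v
        ... | yes refl = queued (x∈p∪q⁺ (inj₂ (x∈⁅x⁆ v))) (unmoved inv ¬Pv)
                           (subst (0ℤ ℤ.<_) (sym t-new) 0<inc)
                           (subst₂ ℤ._≤_ (sym t-new) (sym top-same) inc≤top)
        ... | no w≢v with status inv w
        ... | untouched w∉S eq t≡0 = untouched (w∉S ∘ S-other w≢v) eq (trans (t-other w≢v) t≡0)
        ... | queued w∈S eq 0<t t≤top = queued (x∈p∪q⁺ (inj₁ w∈S)) eq
                           (subst (0ℤ ℤ.<_) (sym (t-other w≢v)) 0<t)
                           (subst₂ ℤ._≤_ (sym (t-other w≢v)) (sym top-same) t≤top)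
        ... | finished P = finished (popped⁺ P)

        tree⁺ : ∀ w → w ≢ p → 0ℤ ℤ.< t σ⁺ w → ∃₂ λ y e →
                parent σ⁺ w ≡ just (y , e) × Popped σ⁺ y × depth⁺ y < depth⁺ w ×
                Link (F σ) y e w (R σ⁺ y) (R σ⁺ w)
        tree⁺ w w≢p 0<t with w ≟ v
        ... | yes refl =
          u , e , updateAt-updates v (parent σ) , popped⁺ Pu ,
          subst₂ _<_ (sym (depth-other (popped-≢ Pu))) (sym (updateAt-updates v (depth inv))) ℕ.≤-refl ,
          subst₂ (Link (F σ) u e v) (sym (R-other (popped-≢ Pu))) (cong (ℤ._+_ (r v)) (sym t-new)) link
        ... | no w≢v with tree inv w w≢p (subst (0ℤ ℤ.<_) (t-other w≢v) 0<t)
        ... | y , e′ , eq , P , d , l =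
          y , e′ , trans (updateAt-minimal w v (parent σ) w≢v) eq , popped⁺ P ,
          subst₂ _<_ (sym (depth-other (popped-≢ P))) (sym (depth-other w≢v)) d ,
          subst₂ (Link (F σ) y e′ w) (sym (R-other (popped-≢ P))) (sym (R-other w≢v)) l

-- Counting the edges with positive slack

module _ (G : Graph) where
  open Graph G
  open State

  positive? : ∀ H (r : Rank G) → Decidable λ e → e ∈ H × 0ℤ ℤ.< slack G e r
  positive? H r e = (e ∈? H) ×-dec (0ℤ ℤ.<? slack G e r)

  positive : Subset m → Rank G → Subset m
  positive H r = tabulate λ e → does (positive? H r e)

  ∣positive∣-< : ∀ {H H′} r r′ e → e ∈ H → 0ℤ ℤ.< slack G e r →
    ¬ (e ∈ H′ × 0ℤ ℤ.< slack G e r′) →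
    (∀ f → f ∈ H′ → 0ℤ ℤ.< slack G f r′ → f ∈ H × 0ℤ ℤ.< slack G f r) →
    ∣ positive H′ r′ ∣ < ∣ positive H r ∣
  ∣positive∣-< {H} {H′} r r′ e e∈H 0<e ¬e sub = p⊂q⇒∣p∣<∣q∣
    ( (λ {f} f∈ → let f∈H′ , 0<f = ∈-tabulate⁻ (positive? H′ r′) f∈ in
                  ∈-tabulate⁺ (positive? H r) (sub f f∈H′ 0<f))
    , e , ∈-tabulate⁺ (positive? H r) (e∈H , 0<e) , ¬e ∘ ∈-tabulate⁻ (positive? H′ r′))

-- Processing the edges of the popped vertex

module _ (G : Graph) (κ : Call G) where
  open Graph G
  open State
  open Call κ
  open Relief G κ
  open Popped
  open Inv

  module _ {σ e} (P : Popped σ (src e)) (current : t σ (src e) ≡ top σ) where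

    -- The edge was forward w.r.t. `r`, and its head, popped earlier, has been raised at least as
    -- much as its tail.
    popped-forward : Ready (F σ) → e ∉ F σ → Popped σ (tgt e) → R σ (src e) ℤ.< R σ (tgt e)
    popped-forward ready e∉F P′ = ℤ.+-mono-<-≤ (Ready.outside-forward ready e∉F)
      (ℤ.≤-trans (ℤ.≤-reflexive current) (high P′))

    -- A skip has three possible causes, each sufficient: the head is popped, the head already lies
    -- higher, or its pending raise is already large enough.
    out-skip-ok : ∀ {T₁ T₂} → Ready (F σ) → Inv σ T₁ T₂ → ¬ OutUpdate G σ e →
                  e ∉ F σ → R σ (src e) ℤ.< R σ (tgt e)
    out-skip-ok ready inv ¬upd e∉F with popped? inv (tgt e) | r′ σ (tgt e) ℤ.≤? r′ σ (src e)
    ... | yes P′ | _ = popped-forward ready e∉F P′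
    ... | no ¬P′ | no ≰ =
      ℤ.<-≤-trans (subst₂ ℤ._<_ (settled P) (unmoved inv ¬P′) (ℤ.≰⇒> ≰)) (r≤R inv (tgt e))
    ... | no ¬P′ | yes ≤ = lemma (R σ (src e)) (r (tgt e)) (t σ (tgt e))
      (subst₂ (λ x y → x ℤ.+ 1ℤ ℤ.- y ℤ.≤ t σ (tgt e)) (settled P) (unmoved inv ¬P′)
        (ℤ.≮⇒≥ λ t< → ¬upd (e∉F , ≤ , t<)))
      where
      lemma : ∀ a b c → a ℤ.+ 1ℤ ℤ.- b ℤ.≤ c → a ℤ.< b ℤ.+ c
      lemma a b c h = close< (gap h) (solve (a ∷ b ∷ c ∷ []))

    module OutPush {T₁ T₂} (ready : Ready (F σ)) (inv : Inv σ T₁ T₂) (upd : OutUpdate G σ e) where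
      private
        u = src e
        v = tgt e
        inc = outIncrement G σ e

        e∉F : e ∉ F σ
        e∉F = proj₁ upd

        fresh : ¬ Popped σ v
        fresh P′ = ℤ.<⇒≱ (popped-forward ready e∉F P′)
          (subst₂ ℤ._≤_ (settled P′) (settled P) (proj₁ (proj₂ upd)))

        inc≡ : inc ≡ R σ u ℤ.+ 1ℤ ℤ.- r v
        inc≡ = cong₂ (λ x y → x ℤ.+ 1ℤ ℤ.- y) (settled P) (unmoved inv fresh)

        inc>0 : 0ℤ ℤ.< inc
        inc>0 = lemma (r′ σ u) (r′ σ v) (proj₁ (proj₂ upd))
          where
          lemma : ∀ a b → b ℤ.≤ a → 0ℤ ℤ.< a ℤ.+ 1ℤ ℤ.- b
          lemma a b h = close< (gap h) (solve (a ∷ b ∷ []))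

      -- As `r v` is at least `r u + 1`, the increment is at most the raise of `u`, which is the
      -- priority just popped.
      inc≤top : inc ℤ.≤ top σ
      inc≤top = subst₂ ℤ._≤_ (sym inc≡) current
        (lemma (r u) (t σ u) (r v) (Ready.outside-forward ready e∉F))
        where
        lemma : ∀ a b c → a ℤ.< c → a ℤ.+ b ℤ.+ 1ℤ ℤ.- c ℤ.≤ b
        lemma a b c h = close (gap< h) (solve (a ∷ b ∷ c ∷ []))

      private
        tight : r v ℤ.+ inc ≡ R σ u ℤ.+ 1ℤ
        tight = trans (cong (ℤ._+_ (r v)) inc≡) (lemma (R σ u) (r v))
          where
          lemma : ∀ a b → b ℤ.+ (a ℤ.+ 1ℤ ℤ.- b) ≡ a ℤ.+ 1ℤ
          lemma a b = solve (a ∷ b ∷ [])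

        module P⁺ = Push inv P fresh inc>0 (proj₂ (proj₂ upd)) inc≤top (forward e∉F refl refl tight)

      popped⁺ : Popped P⁺.σ⁺ u
      popped⁺ = P⁺.popped⁺ P

      current⁺ : t P⁺.σ⁺ u ≡ top P⁺.σ⁺
      current⁺ = trans (P⁺.t-other (P⁺.popped-≢ P)) (trans current (sym P⁺.top-same))

      inv⁺ : Inv P⁺.σ⁺ (T₁ - e) T₂
      inv⁺ = processed-out e (λ _ → subst₂ ℤ._<_ (sym (P⁺.R-other (P⁺.popped-≢ P)))
               (sym (trans (cong (ℤ._+_ (r v)) P⁺.t-new) tight)) (lemma (R σ u))) P⁺.push-inv
        where
        lemma : ∀ a → a ℤ.< a ℤ.+ 1ℤ
        lemma a = close< ℤ.≤-refl (solve (a ∷ []))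

  -- a and b are the old ranks of the endpoints; they are raised by x and y.
  excess-settled : ∀ a b x y → excess a (b ℤ.+ y) ℤ.≤ excess a b ℤ.+ x →
                   excess (a ℤ.+ x) (b ℤ.+ y) ℤ.≤ excess a b
  excess-settled a b x y h = excess-lub (a ℤ.+ x) (b ℤ.+ y)
    (lemma (excess a b) (ℤ.≤-trans (excess-lower a (b ℤ.+ y)) h))
    (excess-nonneg a b)
    where
    lemma : ∀ c → b ℤ.+ y ℤ.- a ℤ.- 1ℤ ℤ.≤ c ℤ.+ x → b ℤ.+ y ℤ.- (a ℤ.+ x) ℤ.- 1ℤ ℤ.≤ c
    lemma c h = close (gap h) (solve (a ∷ b ∷ c ∷ x ∷ y ∷ []))

  excess-raise : ∀ a b y → 0ℤ ℤ.≤ y → excess a (b ℤ.+ y) ℤ.≤ excess a b ℤ.+ y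
  excess-raise a b y 0≤y = excess-mono a (b ℤ.+ y) a b y 0≤y (ℤ.≤-reflexive (solve (a ∷ b ∷ y ∷ [])))

  module _ {σ e} (P : Popped σ (tgt e)) (current : t σ (tgt e) ≡ top σ) where

    -- Raising the head adds at most `top` to the slack; the tail, popped as well, has been raised
    -- by at least `top`.
    popped-slack : Popped σ (src e) → slack G e (R σ) ℤ.≤ slack G e r
    popped-slack P′ = excess-settled (r (src e)) (r (tgt e)) (t σ (src e)) (t σ (tgt e))
      (ℤ.≤-trans (excess-raise (r (src e)) (r (tgt e)) (t σ (tgt e)) (ℤ.<⇒≤ (raised P)))
        (ℤ.+-monoʳ-≤ (slack G e r) (ℤ.≤-trans (ℤ.≤-reflexive current) (high P′))))

    slack-unmoved : r′ σ (src e) ≡ r (src e) → slack G e (r′ σ) ≡ excess (r (src e)) (R σ (tgt e))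
    slack-unmoved eq = cong₂ excess eq (settled P)

    -- Again three causes: the tail is popped, the slack has not grown, or the pending raise of the
    -- tail already makes up for the growth.
    in-skip-ok : ∀ {T₁ T₂} → Inv σ T₁ T₂ → ¬ InUpdate G κ σ e →
                 e ∈ F σ → slack G e (R σ) ℤ.≤ slack G e r
    in-skip-ok inv ¬upd e∈F with popped? inv (src e) | slack G e r ℤ.<? slack G e (r′ σ)
    ... | yes P′ | _ = popped-slack P′
    ... | no ¬P′ | no ≮ = excess-settled (r (src e)) (r (tgt e)) (t σ (src e)) (t σ (tgt e))
      (subst (ℤ._≤ slack G e r ℤ.+ t σ (src e)) (slack-unmoved (unmoved inv ¬P′))
        (ℤ.≤-trans (ℤ.≮⇒≥ ≮) (lemma (slack G e r) (t σ (src e)) (t-nonneg inv (src e)))))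
      where
      lemma : ∀ a b → 0ℤ ℤ.≤ b → a ℤ.≤ a ℤ.+ b
      lemma a b h = close (gap h) (solve (a ∷ b ∷ []))
    ... | no ¬P′ | yes < = excess-settled (r (src e)) (r (tgt e)) (t σ (src e)) (t σ (tgt e))
      (subst (ℤ._≤ slack G e r ℤ.+ t σ (src e)) (slack-unmoved (unmoved inv ¬P′))
        (lemma (slack G e r) (slack G e (r′ σ)) (t σ (src e)) (ℤ.≮⇒≥ λ t< → ¬upd (e∈F , < , t<))))
      where
      lemma : ∀ a b c → b ℤ.- a ℤ.≤ c → b ℤ.≤ a ℤ.+ c
      lemma a b c h = close (gap h) (solve (a ∷ b ∷ c ∷ []))

    module InPush {T₁ T₂} (inv : Inv σ T₁ T₂) (upd : InUpdate G κ σ e) where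
      private
        u = tgt e
        v = src e
        inc = inIncrement G κ σ e
        a = slack G e r

        e∈F : e ∈ F σ
        e∈F = proj₁ upd

        fresh : ¬ Popped σ v
        fresh P′ = ℤ.<⇒≱ (proj₁ (proj₂ upd))
          (subst (ℤ._≤ a) (sym (cong₂ excess (settled P′) (settled P))) (popped-slack P′))

        slack′ : slack G e (r′ σ) ≡ excess (r v) (R σ u)
        slack′ = slack-unmoved (unmoved inv fresh)

        grown : a ℤ.< excess (r v) (R σ u)
        grown = subst (a ℤ.<_) slack′ (proj₁ (proj₂ upd))

        inc≡ : inc ≡ excess (r v) (R σ u) ℤ.- a
        inc≡ = cong (ℤ._- a) slack′

        inc>0 : 0ℤ ℤ.< inc
        inc>0 = lemma a (slack G e (r′ σ)) (proj₁ (proj₂ upd))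
          where
          lemma : ∀ x y → x ℤ.< y → 0ℤ ℤ.< y ℤ.- x
          lemma x y h = close< (gap< h) (solve (x ∷ y ∷ []))

      inc≤top : inc ℤ.≤ top σ
      inc≤top = subst₂ ℤ._≤_ (sym inc≡) current
        (lemma a (excess (r v) (R σ u)) (t σ u) (excess-raise (r v) (r u) (t σ u) (ℤ.<⇒≤ (raised P))))
        where
        lemma : ∀ x y z → y ℤ.≤ x ℤ.+ z → y ℤ.- x ℤ.≤ z
        lemma x y z h = close (gap h) (solve (x ∷ y ∷ z ∷ []))

      private
        tight : R σ u ℤ.- (r v ℤ.+ inc) ℤ.- 1ℤ ≡ a
        tight = trans (cong (λ x → R σ u ℤ.- (r v ℤ.+ x) ℤ.- 1ℤ)
                  -- The grown slack exceeds the nonnegative old one, so it is not truncated, and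
                  -- the increment restores the old slack exactly. Equality matters later, when the
                  -- edge is deleted.
                  (trans inc≡ (cong (ℤ._- a) (excess-pos (r v) (R σ u) (excess-nonneg (r v) (r u)) grown))))
                  (lemma (r v) (R σ u) a)
          where
          lemma : ∀ x y z → y ℤ.- (x ℤ.+ (y ℤ.- x ℤ.- 1ℤ ℤ.- z)) ℤ.- 1ℤ ≡ z
          lemma x y z = solve (x ∷ y ∷ z ∷ [])

        module P⁺ = Push inv P fresh inc>0 (proj₂ (proj₂ upd)) inc≤top (reverse e∈F refl refl tight)

      popped⁺ : Popped P⁺.σ⁺ u
      popped⁺ = P⁺.popped⁺ P

      current⁺ : t P⁺.σ⁺ u ≡ top P⁺.σ⁺
      current⁺ = trans (P⁺.t-other (P⁺.popped-≢ P)) (trans current (sym P⁺.top-same))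

      inv⁺ : Inv P⁺.σ⁺ T₁ (T₂ - e)
      inv⁺ = processed-in e (λ _ → subst₂ (λ x y → excess x y ℤ.≤ a)
               (cong (ℤ._+_ (r v)) (sym P⁺.t-new)) (sym (P⁺.R-other (P⁺.popped-≢ P)))
               (excess-lub (r v ℤ.+ inc) (R σ u) (ℤ.≤-reflexive tight) (excess-nonneg (r v) (r u)))) P⁺.push-inv

  -- Ranks and slacks when the queue is empty

  module Drained {σ} (ready : Ready (F σ)) (inv : Inv σ ⊥ ⊥) (empty : Empty (S σ)) where

    final : ∀ v → r′ σ v ≡ R σ v
    final v with status inv v
    ... | untouched _ eq t≡0 = trans eq (sym (trans (cong (ℤ._+_ (r v)) t≡0) (ℤ.+-identityʳ (r v))))
    ... | queued v∈S _ _ _   = contradiction (v , v∈S) empty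
    ... | finished P         = settled P

    untouched-R : ∀ {v} → ¬ Popped σ v → R σ v ≡ r v
    untouched-R {v} ¬P = trans (sym (final v)) (unmoved inv ¬P)

    -- If the tail was popped, its out-edges have been processed. Otherwise the tail has not moved,
    -- and the head can only have risen.
    stays-forward : ∀ {e} → e ∉ F σ → r′ σ (src e) ℤ.< r′ σ (tgt e)
    stays-forward {e} e∉F = subst₂ ℤ._<_ (sym (final (src e))) (sym (final (tgt e))) R<R
      where
      R<R : R σ (src e) ℤ.< R σ (tgt e)
      R<R with popped? inv (src e)
      ... | yes P = out-ok inv e e∉F P ∉⊥
      ... | no ¬P = subst (ℤ._< R σ (tgt e)) (sym (untouched-R ¬P))
                      (ℤ.<-≤-trans (Ready.outside-forward ready e∉F) (r≤R inv (tgt e)))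

    inside-slack : ∀ {e} → e ∈ F σ → slack G e (r′ σ) ℤ.≤ slack G e r
    inside-slack {e} e∈F = subst₂ (λ x y → excess x y ℤ.≤ slack G e r)
      (sym (final (src e))) (sym (final (tgt e))) R-slack
      where
      R-slack : slack G e (R σ) ℤ.≤ slack G e r
      R-slack with popped? inv (tgt e)
      ... | yes P = in-ok inv e e∈F P ∉⊥
      ... | no ¬P = subst (λ x → excess (R σ (src e)) x ℤ.≤ slack G e r) (sym (untouched-R ¬P))
                      (excess-antitoneˡ (r (src e)) (R σ (src e)) (r (tgt e)) (r≤R inv (src e)))

    keep-feasible : Feasible G (F σ) (r′ σ)
    keep-feasible = record
      { eulerian = Ready.eulerian ready
      ; conforms = conforms′
      ; bounded  = λ e e∈F → ℤ.≤-trans (inside-slack e∈F) (Ready.bounded ready e e∈F)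
      }
      where
      conforms′ : Conforms G (r′ σ) (F σ)
      conforms′ e back with e ∈? F σ
      ... | yes e∈F = e∈F
      ... | no e∉F  = contradiction back (ℤ.<⇒≱ (stays-forward e∉F))

    keep-progress : slack G ps (r′ σ) ℤ.≤ 0ℤ → ∣ positive G (F σ) (r′ σ) ∣ < ∣ positive G (F σ) r ∣
    keep-progress ≤0 = ∣positive∣-< G r (r′ σ) ps (Ready.ps∈H ready) (Ready.slack>0 ready)
      (λ (_ , 0<) → ℤ.<⇒≱ 0< ≤0)
      (λ f f∈F 0<f → f∈F , ℤ.<-≤-trans 0<f (inside-slack f∈F))

  -- Membership in `H` decides which end of the edge is the child, so an edge is the parent link of
  -- at most one vertex. This keeps the walk from repeating an edge.
  link-unique : ∀ {H e y y′ v v′ a a′ b b′} → Link H y e v a b → Link H y′ e v′ a′ b′ → v ≡ v′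
  link-unique (forward _ _ p _)   (forward _ _ q _)   = trans (sym p) q
  link-unique (forward e∉H _ _ _) (reverse e∈H _ _ _) = contradiction e∈H e∉H
  link-unique (reverse e∈H _ _ _) (forward e∉H _ _ _) = contradiction e∈H e∉H
  link-unique (reverse _ _ p _)   (reverse _ _ q _)   = trans (sym p) q

  -- The edges in O form a path from s down to x in the tree of parent links;
  -- flipping them has left a surplus outflow of 1 at x and a deficit at s.
  record Walk (σ : State G) (x : Fin n) (O : Subset m) : Set where
    field
      inv     : Inv σ ⊥ ⊥
      drained : Empty (S σ)
      blocked : 0ℤ ℤ.< slack G ps (r′ σ)
      reached : 0ℤ ℤ.< t σ x
      marked  : ∀ {e} → e ∈ O → ∃₂ λ y v →
                depth inv x < depth inv v × Link (F σ) y e v (R σ y) (R σ v)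
      flux    : ∀ v → balance G (symDiff (F σ) O) v ≡ δ x v ℤ.- δ s v
  open Walk

  -- The vertex `p` rises by exactly the old slack of `(p , s)`, so the slack that remains equals
  -- `t σ s`; if it is positive, the search has reached `s`.
  walk-start : ∀ {σ} → Ready (F σ) → Inv σ ⊥ ⊥ → Empty (S σ) → 0ℤ ℤ.< slack G ps (r′ σ) →
               Walk σ s ⊥
  walk-start {σ} ready inv empty 0<slack = record
    { inv     = inv
    ; drained = empty
    ; blocked = 0<slack
    ; reached = subst (0ℤ ℤ.<_) slack≡t 0<slack
    ; marked  = λ e∈⊥ → contradiction e∈⊥ ∉⊥
    ; flux    = λ v → trans (trans (sum-cong-≗ λ e → cong (ℤ._* flow G e v) (same e))
                  (eulerian⇒balanced G (F σ) (Ready.eulerian ready) v))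
                  (sym (ℤ.i≡j⇒i-j≡0 {δ s v} refl))
    }
    where
    open Drained ready inv empty
    lemma : ∀ a b c → b ℤ.+ c ℤ.- (a ℤ.+ (b ℤ.- a ℤ.- 1ℤ)) ℤ.- 1ℤ ≡ c
    lemma a b c = solve (a ∷ b ∷ c ∷ [])
    slack≡t : slack G ps (r′ σ) ≡ t σ s
    slack≡t = trans (excess-pos (r′ σ p) (r′ σ s) ℤ.≤-refl 0<slack)
      (trans (cong₂ (λ x y → y ℤ.- x ℤ.- 1ℤ)
               (trans (final p) (cong (ℤ._+_ (r p)) (t-p inv))) (final s))
             (lemma (r p) (r s) (t σ s)))
    same : ∀ e → [ e ∈ symDiff (F σ) ⊥ ]? ≡ [ e ∈ F σ ]?
    same e = [∈]-cong (symDiff (F σ) ⊥) (F σ)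
      (λ e∈ → [ proj₁ , (λ x → contradiction (proj₂ x) ∉⊥) ]′ (∈-symDiff⁻ (F σ) ⊥ e∈))
      (λ e∈F → ∈-symDiffˡ e∈F ∉⊥)

  -- Every edge in `O` is the link of a child strictly deeper than `x`, whereas the child of `e` is
  -- `x` itself. Hence `e` is new.
  walk-follow : ∀ {σ x O y e} → Walk σ x O → x ≢ p → parent σ x ≡ just (y , e) →
                e ∉ O × Walk σ y (O ∪ ⁅ e ⁆)
  walk-follow {σ} {x} {O} W x≢p parent≡ with tree (inv W) x x≢p (reached W)
  ... | y , e , parent≡′ , P , deeper , link with just-injective (trans (sym parent≡) parent≡′)
  ... | refl = e∉O , record
    { inv     = inv W
    ; drained = drained W
    ; blocked = blocked W
    ; reached = raised P
    ; marked  = λ f∈ → marked′ (x∈p∪q⁻ O ⁅ e ⁆ f∈)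
    ; flux    = flux′ link
    }
    where
    e∉O : e ∉ O
    e∉O e∈O with marked W e∈O
    ... | _ , v , x<v , link′ = ℕ.<-irrefl (cong (depth (inv W)) (link-unique link link′)) x<v
    marked′ : ∀ {f} → f ∈ O ⊎ f ∈ ⁅ e ⁆ → ∃₂ λ z v →
              depth (inv W) y < depth (inv W) v × Link (F σ) z f v (R σ z) (R σ v)
    marked′ (inj₁ f∈O) with marked W f∈O
    ... | z , v , x<v , link′ = z , v , ℕ.<-trans deeper x<v , link′
    marked′ (inj₂ f∈⁅e⁆) with refl ← x∈⁅y⁆⇒x≡y e f∈⁅e⁆ = y , x , deeper , link
    -- Inserting an edge from `y` to `x` and deleting one from `x` to `y` have the same effect: both
    -- move the surplus from `x` to its parent `y`.
    flux′ : ∀ {a b} → Link (F σ) y e x a b → ∀ v →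
            balance G (symDiff (F σ) (O ∪ ⁅ e ⁆)) v ≡ δ y v ℤ.- δ s v
    flux′ (forward e∉F refl refl _) v = trans (balance-flip-∉ G (F σ) O e v e∉O e∉F)
      (trans (cong (ℤ._+ flow G e v) (flux W v)) (lemma (δ x v) (δ y v) (δ s v)))
      where
      lemma : ∀ a b c → a ℤ.- c ℤ.+ (b ℤ.- a) ≡ b ℤ.- c
      lemma a b c = solve (a ∷ b ∷ c ∷ [])
    flux′ (reverse e∈F refl refl _) v = trans (balance-flip-∈ G (F σ) O e v e∉O e∈F)
      (trans (cong (ℤ._- flow G e v) (flux W v)) (lemma (δ x v) (δ y v) (δ s v)))
      where
      lemma : ∀ a b c → a ℤ.- c ℤ.- (a ℤ.- b) ≡ b ℤ.- c
      lemma a b c = solve (a ∷ b ∷ c ∷ [])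

  module Flip {σ O} (ready : Ready (F σ)) (W : Walk σ p O) where
    open Drained ready (inv W) (drained W)

    H′ : Subset m
    H′ = symDiff (F σ) O - ps

    private
      -- Being in `F`, the edge could only be a reverse link with child `p`, but the children in `O`
      -- are strictly deeper than the current vertex, which is `p`.
      ps∉O : ps ∉ O
      ps∉O ps∈O with marked W ps∈O
      ... | _ , _ , p<v , forward ps∉F _ _ _ = ps∉F (Ready.ps∈H ready)
      ... | _ , _ , p<v , reverse _ _ refl _ = ℕ.<-irrefl refl p<v

      added-tight : ∀ {e} → e ∉ F σ → e ∈ O → slack G e (r′ σ) ℤ.≤ 0ℤ
      added-tight {e} e∉F e∈O with marked W e∈O
      ... | _ , _ , _ , reverse e∈F _ _ _ = contradiction e∈F e∉F
      ... | _ , _ , _ , forward _ refl refl eq =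
        excess-lub (r′ σ (src e)) (r′ σ (tgt e)) (ℤ.≤-reflexive
          (trans (cong₂ (λ x y → y ℤ.- x ℤ.- 1ℤ) (final (src e)) (trans (final (tgt e)) eq))
                 (lemma (R σ (src e))))) ℤ.≤-refl
        where
        lemma : ∀ a → a ℤ.+ 1ℤ ℤ.- a ℤ.- 1ℤ ≡ 0ℤ
        lemma a = solve (a ∷ [])

      -- A reverse link equates the untruncated final slack with the old slack, which is
      -- nonnegative.
      deleted-forward : ∀ {e} → e ∈ F σ → e ∈ O → r′ σ (src e) ℤ.< r′ σ (tgt e)
      deleted-forward {e} e∈F e∈O with marked W e∈O
      ... | _ , _ , _ , forward e∉F _ _ _ = contradiction e∈F e∉F
      ... | _ , _ , _ , reverse _ refl refl eq = subst₂ ℤ._<_ (sym (final (src e))) (sym (final (tgt e)))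
        (lemma (R σ (src e)) (R σ (tgt e))
          (subst (0ℤ ℤ.≤_) (sym eq) (excess-nonneg (r (src e)) (r (tgt e)))))
        where
        lemma : ∀ a b → 0ℤ ℤ.≤ b ℤ.- a ℤ.- 1ℤ → a ℤ.< b
        lemma a b h = close< (gap h) (solve (a ∷ b ∷ []))

      member : ∀ {e} → e ∈ H′ → (e ∈ F σ × e ∉ O) ⊎ (e ∉ F σ × e ∈ O)
      member e∈ = ∈-symDiff⁻ (F σ) O (p─q⊆p (symDiff (F σ) O) ⁅ ps ⁆ e∈)

      -- The deleted edge `ps` is forward because its slack is still positive, by `blocked`; the
      -- other cases are edges never in `F` and edges flipped out of it.
      non-member : ∀ {e} → e ∉ H′ → r′ σ (src e) ℤ.< r′ σ (tgt e)
      non-member {e} e∉ with x∉p-y⇒x≡y⊎x∉p ps e∉ | e ∈? F σ | e ∈? O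
      ... | inj₁ refl | _       | _       = excess-pos⇒< (r′ σ p) (r′ σ s) ℤ.≤-refl (blocked W)
      ... | inj₂ _    | no e∉F  | _       = stays-forward e∉F
      ... | inj₂ _    | yes e∈F | yes e∈O = deleted-forward e∈F e∈O
      ... | inj₂ e∉Δ  | yes e∈F | no e∉O  = contradiction (∈-symDiffˡ e∈F e∉O) e∉Δ

    flip-feasible : Feasible G H′ (r′ σ)
    flip-feasible = record
      -- The walk has ended at `p`, so surplus and deficit form exactly the flow of `ps`, and
      -- deleting `ps` cancels them.
      { eulerian = balanced⇒eulerian G H′ λ v →
          trans (balance-remove G (symDiff (F σ) O) ps v (∈-symDiffˡ (Ready.ps∈H ready) ps∉O))
                (ℤ.i≡j⇒i-j≡0 (flux W v))
      ; conforms = conforms′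
      ; bounded  = λ e e∈ → [ (λ (e∈F , _) → ℤ.≤-trans (inside-slack e∈F) (Ready.bounded ready e e∈F))
                            , (λ (e∉F , e∈O) → ℤ.≤-trans (added-tight e∉F e∈O) (ℤ.+≤+ z≤n)) ]′ (member e∈)
      }
      where
      conforms′ : Conforms G (r′ σ) H′
      conforms′ e back with e ∈? H′
      ... | yes e∈ = e∈
      ... | no e∉  = contradiction back (ℤ.<⇒≱ (non-member e∉))

    flip-progress : ∣ positive G H′ (r′ σ) ∣ < ∣ positive G (F σ) r ∣
    flip-progress = ∣positive∣-< G r (r′ σ) ps (Ready.ps∈H ready) (Ready.slack>0 ready)
      (λ (ps∈ , _) → x∈p-y⇒x≢y (symDiff (F σ) O) ps∈ refl)
      (λ f f∈ 0<f → [ (λ (f∈F , _) → f∈F , ℤ.<-≤-trans 0<f (inside-slack f∈F))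
                    , (λ (f∉F , f∈O) → contradiction (added-tight f∉F f∈O) (ℤ.<⇒≱ 0<f)) ]′ (member f∈))

-- Progress and cost

charge : ∀ x {y z} → suc y ≤ z → suc (x + y) ≤ x + z
charge x {y} {z} h = subst (_≤ x + z) (ℕ.+-suc x y) (ℕ.+-monoʳ-≤ x h)

module _ (G : Graph) (κ : Call G) where
  open Graph G
  open State
  open Call κ
  open Relief G κ

  unmoved? : (f : Fin k → Fin n) (ρ : Rank G) → Decidable λ i → ρ (f i) ≡ r (f i)
  unmoved? f ρ i = ρ (f i) ℤ.≟ r (f i)

  -- A pop raises its vertex strictly, so an unchanged rank identifies the vertices not yet popped.
  -- With `id`, `src` and `tgt` for `f` this counts the vertices, out-edges and in-edges still to be
  -- processed.
  unmovedAt : (Fin k → Fin n) → Rank G → Subset k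
  unmovedAt f ρ = tabulate λ i → does (unmoved? f ρ i)

  unmoved-pop : ∀ (f : Fin k → Fin n) {σ u} (inv : Inv σ ⊥ ⊥) (u∈S : u ∈ S σ) → t σ u ≡ top σ →
    ∣ unmovedAt f (r′ (popped G u σ)) ∣ + ∣ tabulate (λ i → does (f i ≟ u)) ∣ ≤ ∣ unmovedAt f (r′ σ) ∣
  unmoved-pop f {σ} {u} inv u∈S t≡top = ∣p∣+∣q∣≤∣r∣ (unmovedAt f (r′ σ⁺)) (tabulate λ i → does (f i ≟ u)) (unmovedAt f (r′ σ))
    (λ i∈ → let eq = ∈-tabulate⁻ (unmoved? f (r′ σ⁺)) i∈ in
      ∈-tabulate⁺ (unmoved? f (r′ σ)) (trans (sym (other-rank (moved eq))) eq))
    (λ i∈ → ∈-tabulate⁺ (unmoved? f (r′ σ))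
      (subst (λ v → r′ σ v ≡ r v) (sym (∈-tabulate⁻ (λ i → f i ≟ u) i∈)) (Inv.queued-rank inv u∈S)))
    (λ i∈ i∈′ → moved (∈-tabulate⁻ (unmoved? f (r′ σ⁺)) i∈) (∈-tabulate⁻ (λ i → f i ≟ u) i∈′))
    where
    open Pop inv u∈S t≡top
    lemma : ∀ a b → a ℤ.+ b ≡ a → b ℤ.≤ 0ℤ
    lemma a b h = close (gap (ℤ.≤-reflexive h)) (solve (a ∷ b ∷ []))
    moved : ∀ {v} → r′ σ⁺ v ≡ r v → v ≢ u
    moved eq refl = ℤ.<⇒≱ (Popped.raised new)
      (lemma (r u) (t σ u) (trans (sym (Popped.settled new)) eq))

module _ (G : Graph) where
  open Graph G
  open State

  -- A call of Relief costs at most `round` together with the step `pick` before it;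
  -- `exit` pays for what follows its loop.
  exit round : ℕ
  exit  = 1 + m + (m + (1 + m))
  round = (1 + m + m + m) + ((1 + m + (n + n + n + n) + m) + (m + ((3 * n + (m + m)) + exit)))

  -- The count refers to the start of the running call, whose own `round` is accounted for
  -- separately, hence `pred`. The last summand pays for `stop`.
  after : Call G → Subset m → ℕ
  after κ H = pred ∣ positive G H (Call.r κ) ∣ * round + (1 + m + m)

  -- Three units per vertex for `pop`, `out-done` and `in-done`, and one unit for each edge at
  -- either of its ends.
  pending : Call G → Rank G → ℕ
  pending κ ρ = 3 * ∣ unmovedAt G κ id ρ ∣ + (∣ unmovedAt G κ src ρ ∣ + ∣ unmovedAt G κ tgt ρ ∣)

  -- The absolute value of `top` pays for the remaining descents, as `top` never rises, and the size
  -- of the complement of `O` for the remaining links, as each of them adds a new edge to `O`.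
  potential : Config G → ℕ
  potential (test H r)      = ∣ positive G H r ∣ * round + (1 + m + m)
  potential (enter κ H)     = (1 + m + (n + n + n + n) + ℤ.∣ Call.capacity κ ∣) +
    (ℤ.∣ Call.capacity κ ∣ + ((3 * n + (m + m)) + (exit + after κ H)))
  potential (loop κ σ)      = ℤ.∣ top σ ∣ + (pending κ (r′ σ) + (exit + after κ (F σ)))
  potential (outs κ σ u T)  = ℤ.∣ top σ ∣ +
    (∣ T ∣ + (1 + (∣ inEdges G u ∣ + 1)) + (pending κ (r′ σ) + (exit + after κ (F σ))))
  potential (ins κ σ u T)   = ℤ.∣ top σ ∣ + (∣ T ∣ + 1 + (pending κ (r′ σ) + (exit + after κ (F σ))))
  potential (walk κ σ x O)  = ∣ ∁ O ∣ + (1 + m + after κ (F σ))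
  potential (halt H r)      = 0

  Valid : Config G → Set
  Valid (test H r)     = Feasible G H r
  Valid (enter κ H)    = Relief.Ready G κ H
  Valid (loop κ σ)     = Relief.Ready G κ (F σ) × Relief.Inv G κ σ ⊥ ⊥
  Valid (outs κ σ u T) = Relief.Ready G κ (F σ) × Relief.Inv G κ σ T (inEdges G u) ×
    Relief.Popped G κ σ u × t σ u ≡ top σ × T ⊆ outEdges G u
  Valid (ins κ σ u T)  = Relief.Ready G κ (F σ) × Relief.Inv G κ σ ⊥ T ×
    Relief.Popped G κ σ u × t σ u ≡ top σ × T ⊆ inEdges G u
  Valid (walk κ σ x O) = Relief.Ready G κ (F σ) × Walk G κ σ x O
  Valid (halt H r)     = Unit.⊤

  some-slack : ∀ {H r} → Feasible G H r → + ∣ H ∣ ℤ.< agony G r →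
               ¬ (∀ e → e ∈ H → slack G e r ℤ.≤ 0ℤ)
  some-slack {r = r} feasible |H|<agony tight = ℤ.<-irrefl
    (sym (tight⇒agony≡size G {r = r} (Feasible.eulerian feasible) (Feasible.conforms feasible) tight)) |H|<agony

  outUpdate? : ∀ σ e → Dec (OutUpdate G σ e)
  outUpdate? σ e = ¬? (e ∈? F σ) ×-dec
    (r′ σ (tgt e) ℤ.≤? r′ σ (src e)) ×-dec (t σ (tgt e) ℤ.<? outIncrement G σ e)

  inUpdate? : ∀ κ σ e → Dec (InUpdate G κ σ e)
  inUpdate? κ σ e = (e ∈? F σ) ×-dec
    (slack G e (Call.r κ) ℤ.<? slack G e (r′ σ)) ×-dec (t σ (src e) ℤ.<? inIncrement G κ σ e)

  -- The delicate guards are those of updates, where the increment is at most `top` and so within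
  -- the capacity, and of the walk, where a raised vertex other than `p` has a parent.
  progress : ∀ {x} → Valid x → Halted G x ⊎ ∃₂ λ j y → _—[_]→_ G x j y
  progress {test H r} feasible with agony G r ℤ.≤? + ∣ H ∣
  ... | yes ≤ = inj₂ (_ , _ , stop ≤)
  ... | no ≰ with argmax H (λ e → slack G e r)
  ...   | inj₁ empty             = contradiction (λ e e∈H → contradiction (e , e∈H) empty)
                                     (some-slack {r = r} feasible (ℤ.≰⇒> ≰))
  ...   | inj₂ (ps , ps∈H , max) = inj₂ (_ , _ , pick (ℤ.≰⇒> ≰) ps∈H max)
  progress {enter κ H} _ = inj₂ (_ , _ , init)
  progress {loop κ σ} (ready , inv) with nonempty? (S σ)
  ... | yes S≢∅ with any? (λ v → (v ∈? S σ) ×-dec (t σ v ℤ.≟ top σ))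
  ...   | yes (u , u∈S , t≡top) = inj₂ (_ , _ , pop u∈S
            (λ v v∈S → subst (t σ v ℤ.≤_) (sym t≡top) (Relief.Inv.queued-bound inv v∈S)) t≡top)
  ...   | no none = inj₂ (_ , _ , descend S≢∅ λ v v∈S t≡top → none (v , v∈S , t≡top))
  progress {loop κ σ} (ready , inv) | no S≡∅ with slack G (Call.ps κ) (r′ σ) ℤ.≤? 0ℤ
  ...   | yes ≤ = inj₂ (_ , _ , keep S≡∅ ≤)
  ...   | no ≰  = inj₂ (_ , _ , modify S≡∅ (ℤ.≰⇒> ≰))
  progress {outs κ σ u T} (ready , inv , P , current , T⊆) with nonempty? T
  ... | no empty = inj₂ (_ , _ , out-done empty)
  ... | yes (e , e∈T) with refl ← ∈-tabulate⁻ (λ f → src f ≟ u) (T⊆ e∈T) | outUpdate? σ e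
  ...   | yes upd = inj₂ (_ , _ , out-update e∈T upd
            (ℤ.≤-trans (OutPush.inc≤top G κ P current ready inv upd) (Relief.Inv.top-bound inv)))
  ...   | no ¬upd = inj₂ (_ , _ , out-skip e∈T ¬upd)
  progress {ins κ σ u T} (ready , inv , P , current , T⊆) with nonempty? T
  ... | no empty = inj₂ (_ , _ , in-done empty)
  ... | yes (e , e∈T) with refl ← ∈-tabulate⁻ (λ f → tgt f ≟ u) (T⊆ e∈T) | inUpdate? κ σ e
  ...   | yes upd = inj₂ (_ , _ , in-update e∈T upd
            (ℤ.≤-trans (InPush.inc≤top G κ P current inv upd) (Relief.Inv.top-bound inv)))
  ...   | no ¬upd = inj₂ (_ , _ , in-skip e∈T ¬upd)
  progress {walk κ σ x O} (ready , W) with x ≟ Call.p κ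
  ... | yes refl = inj₂ (_ , _ , flip)
  ... | no x≢p with Relief.Inv.tree (Walk.inv W) x x≢p (Walk.reached W)
  ...   | _ , _ , parent≡ , _ = inj₂ (_ , _ , follow x≢p parent≡)
  progress {halt H r} _ = inj₁ (H , r , refl)

  next-round : ∀ {a b} → a < b → a * round + (1 + m + m) ≤ pred b * round + (1 + m + m)
  next-round {b = suc b} a<b = ℕ.+-monoˡ-≤ (1 + m + m) (ℕ.*-monoˡ-≤ round (s≤s⁻¹ a<b))

  -- The capacity is paid for twice, once to initialise the buckets and once for the descent of
  -- `top`; both are bounded by `m` here. The edge `ps` itself has positive slack, so there is a
  -- `round` to spend.
  pick-cost : ∀ {H r ps} → Relief.Ready G (call ps r) H →
              1 + m + m + m + potential (enter (call ps r) H) ≤ potential (test H r)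
  pick-cost {H} {r} {ps} ready = budget _ (ℕ.≤-trans (s≤s z≤n) (p⊂q⇒∣p∣<∣q∣ nonempty)) _
    (ℤ.drop‿+≤+ (subst (ℤ._≤ + m) (sym (ℤ.0≤i⇒+∣i∣≡i (ℤ.<⇒≤ capacity>0))) capacity≤m))
    where
    open Relief.Ready ready
    nonempty : ⊥ ⊂ positive G H r
    nonempty = ⊥⊆ , ps , ∈-tabulate⁺ (positive? G H r) (ps∈H , slack>0) , ∉⊥
    budget : ∀ b → 1 ≤ b → ∀ c → c ≤ m →
      1 + m + m + m + ((1 + m + (n + n + n + n) + c) +
        (c + ((3 * n + (m + m)) + (exit + (pred b * round + (1 + m + m))))))
      ≤ b * round + (1 + m + m)
    budget (suc b) _ c c≤m = ℕ.≤-trans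
      (ℕ.+-monoʳ-≤ (1 + m + m + m) (ℕ.+-mono-≤
        (ℕ.+-monoʳ-≤ (1 + m + (n + n + n + n)) c≤m)
        (ℕ.+-monoˡ-≤ ((3 * n + (m + m)) + (exit + (b * round + (1 + m + m)))) c≤m)))
      (ℕ.≤-reflexive (regroup (1 + m + m + m) (1 + m + (n + n + n + n) + m) m (3 * n + (m + m)) exit
                              (b * round) (1 + m + m)))
      where
      regroup : ∀ a b c d e f g → a + (b + (c + (d + (e + (f + g))))) ≡ a + (b + (c + (d + e))) + f + g
      regroup a b c d e f g = solveℕ (a ∷ b ∷ c ∷ d ∷ e ∷ f ∷ g ∷ [])

  pop-cost : ∀ {κ σ u} → Relief.Inv G κ σ ⊥ ⊥ → u ∈ S σ → t σ u ≡ top σ →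
             suc (potential (outs κ (popped G u σ) u (outEdges G u))) ≤ potential (loop κ σ)
  pop-cost {κ} {σ} {u} inv u∈S t≡top = charge ℤ.∣ top σ ∣ (budget
    (before id) (later id) (before src) (later src) (before tgt) (later tgt)
    (∣ outEdges G u ∣) (∣ inEdges G u ∣) (exit + after κ (F σ))
    (ℕ.≤-trans (ℕ.+-monoʳ-≤ (later id) one) (unmoved-pop G κ id inv u∈S t≡top))
    (unmoved-pop G κ src inv u∈S t≡top) (unmoved-pop G κ tgt inv u∈S t≡top))
    where
    before later : (Fin k → Fin n) → ℕ
    before f = ∣ unmovedAt G κ f (r′ σ) ∣
    later f  = ∣ unmovedAt G κ f (r′ (popped G u σ)) ∣
    one : 1 ≤ ∣ tabulate (λ v → does (v ≟ u)) ∣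
    one = ℕ.≤-trans (s≤s z≤n) (p⊂q⇒∣p∣<∣q∣ (⊥⊆ , u , ∈-tabulate⁺ (_≟ u) refl , ∉⊥))
    budget : ∀ a a′ b b′ c c′ o i x → a′ + 1 ≤ a → b′ + o ≤ b → c′ + i ≤ c →
             suc (o + (1 + (i + 1)) + (3 * a′ + (b′ + c′) + x)) ≤ 3 * a + (b + c) + x
    budget a a′ b b′ c c′ o i x ha hb hc = subst (_≤ 3 * a + (b + c) + x)
      (regroup a′ b′ c′ o i x)
      (ℕ.+-monoˡ-≤ x (ℕ.+-mono-≤ (ℕ.*-monoʳ-≤ 3 ha) (ℕ.+-mono-≤ hb hc)))
      where
      regroup : ∀ a b c o i x → 3 * (a + 1) + ((b + o) + (c + i)) + x ≡
                                suc (o + (1 + (i + 1)) + (3 * a + (b + c) + x))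
      regroup a b c o i x = solveℕ (a ∷ b ∷ c ∷ o ∷ i ∷ x ∷ [])

  shrink : ∀ {T : Subset m} {e} → e ∈ T → ∀ c x → suc (∣ T - e ∣ + c + x) ≤ ∣ T ∣ + c + x
  shrink e∈T c x = ℕ.+-monoˡ-≤ x (ℕ.+-monoˡ-≤ c (x∈p⇒∣p-x∣<∣p∣ e∈T))

  top-push : ∀ {τ inc} → inc ℤ.≤ τ → ∀ x {z} → suc (ℤ.∣ τ ∣ + x) ≤ z →
             suc (ℤ.∣ τ ℤ.⊔ inc ∣ + x) ≤ z
  top-push inc≤top x {z} = subst (λ τ → suc (ℤ.∣ τ ∣ + x) ≤ z) (sym (ℤ.i≥j⇒i⊔j≡i inc≤top))

  step : ∀ {x j y} → Valid x → _—[_]→_ G x j y → Valid y × j + potential y ≤ potential x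
  step {test H r} feasible (stop _) = tt ,
    ℕ.≤-trans (ℕ.≤-reflexive (ℕ.+-identityʳ (1 + m + m))) (ℕ.m≤n+m _ _)
  step {test H r} feasible (pick {ps = ps} |H|<agony ps∈H max) = ready , pick-cost ready
    where
    ready : Relief.Ready G (call ps r) H
    ready = record
      { feasible = feasible
      ; ps∈H     = ps∈H
      ; slack>0  = ℤ.≰⇒> λ ≤0 → some-slack {r = r} feasible |H|<agony λ e e∈H → ℤ.≤-trans (max e e∈H) ≤0
      }
  step {enter κ H} ready init = (ready , Relief.initial-inv G κ ready) ,
    ℕ.+-monoʳ-≤ (1 + m + (n + n + n + n) + ℤ.∣ Call.capacity κ ∣) (ℕ.+-monoʳ-≤ ℤ.∣ Call.capacity κ ∣
      (ℕ.+-monoˡ-≤ (exit + after κ H) (ℕ.+-mono-≤ (ℕ.*-monoʳ-≤ 3 (size id)) (ℕ.+-mono-≤ (size src) (size tgt)))))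
    where
    size : ∀ {k} (f : Fin k → Fin n) → ∣ unmovedAt G κ f (Call.r κ) ∣ ≤ k
    size f = ∣p∣≤n (unmovedAt G κ f (Call.r κ))
  step {loop κ σ} (ready , inv) (descend S≢∅ none) =
    let 1≤top , inv′ = Relief.descend-inv G κ inv S≢∅ none in
    (ready , inv′) , ℕ.+-monoˡ-≤ _ (lemma 1≤top)
    where
    lemma : ∀ {a} → 1ℤ ℤ.≤ a → suc ℤ.∣ a ℤ.- 1ℤ ∣ ≤ ℤ.∣ a ∣
    lemma (ℤ.+≤+ (s≤s z≤n)) = ℕ.≤-refl
  step {loop κ σ} (ready , inv) (pop u∈S _ t≡top) =
    (ready , pop-inv , new , t≡top , id) , pop-cost inv u∈S t≡top
    where open Relief.Pop G κ inv u∈S t≡top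
  step {loop κ σ} (ready , inv) (keep S≡∅ ≤0) = keep-feasible , ℕ.≤-trans
    (ℕ.+-mono-≤ {1} {exit} (s≤s z≤n) (next-round (keep-progress ≤0)))
    (ℕ.≤-trans (ℕ.m≤n+m _ (pending κ (r′ σ))) (ℕ.m≤n+m _ ℤ.∣ top σ ∣))
    where open Drained G κ ready inv S≡∅
  step {loop κ σ} (ready , inv) (modify S≡∅ 0<slack) = (ready , walk-start G κ ready inv S≡∅ 0<slack) ,
    ℕ.≤-trans (ℕ.+-monoʳ-≤ (1 + m) (ℕ.+-monoˡ-≤ (1 + m + after κ (F σ)) (∣p∣≤n (∁ ⊥))))
      (ℕ.≤-trans (ℕ.≤-reflexive (regroup (1 + m) m (after κ (F σ))))
        (ℕ.≤-trans (ℕ.m≤n+m _ (pending κ (r′ σ))) (ℕ.m≤n+m _ ℤ.∣ top σ ∣)))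
    where
    regroup : ∀ a b c → a + (b + (a + c)) ≡ a + (b + a) + c
    regroup a b c = solveℕ (a ∷ b ∷ c ∷ [])
  step {outs κ σ u T} (ready , inv , P , current , T⊆) (out-update {e = e} e∈T upd _)
    with refl ← ∈-tabulate⁻ (λ f → src f ≟ u) (T⊆ e∈T) =
    (ready , inv⁺ , popped⁺ , current⁺ , T⊆ ∘ p─q⊆p T ⁅ e ⁆) ,
    top-push inc≤top _ (charge ℤ.∣ top σ ∣ (shrink e∈T _ _))
    where open OutPush G κ P current ready inv upd
  step {outs κ σ u T} (ready , inv , P , current , T⊆) (out-skip {e = e} e∈T ¬upd)
    with refl ← ∈-tabulate⁻ (λ f → src f ≟ u) (T⊆ e∈T) =
    (ready , Relief.processed-out G κ e (out-skip-ok G κ P current ready inv ¬upd) inv ,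
      P , current , T⊆ ∘ p─q⊆p T ⁅ e ⁆) ,
    charge ℤ.∣ top σ ∣ (shrink e∈T _ _)
  step {outs κ σ u T} (ready , inv , P , current , T⊆) (out-done empty) =
    (ready , Relief.processed G κ (λ e _ _ _ → inj₁ λ e∈T → empty (e , e∈T)) (λ _ _ _ → inj₁) inv ,
      P , current , id) ,
    charge ℤ.∣ top σ ∣ (ℕ.+-monoˡ-≤ _ (ℕ.m≤n+m _ ∣ T ∣))
  step {ins κ σ u T} (ready , inv , P , current , T⊆) (in-update {e = e} e∈T upd _)
    with refl ← ∈-tabulate⁻ (λ f → tgt f ≟ u) (T⊆ e∈T) =
    (ready , inv⁺ , popped⁺ , current⁺ , T⊆ ∘ p─q⊆p T ⁅ e ⁆) ,
    top-push inc≤top _ (charge ℤ.∣ top σ ∣ (shrink e∈T _ _))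
    where open InPush G κ P current inv upd
  step {ins κ σ u T} (ready , inv , P , current , T⊆) (in-skip {e = e} e∈T ¬upd)
    with refl ← ∈-tabulate⁻ (λ f → tgt f ≟ u) (T⊆ e∈T) =
    (ready , Relief.processed-in G κ e (in-skip-ok G κ P current inv ¬upd) inv ,
      P , current , T⊆ ∘ p─q⊆p T ⁅ e ⁆) ,
    charge ℤ.∣ top σ ∣ (shrink e∈T _ _)
  step {ins κ σ u T} (ready , inv , P , current , T⊆) (in-done empty) =
    (ready , Relief.processed G κ (λ _ _ _ → inj₁) (λ e _ _ _ → inj₁ λ e∈T → empty (e , e∈T)) inv) ,
    charge ℤ.∣ top σ ∣ (ℕ.+-monoˡ-≤ _ (ℕ.m≤n+m 1 ∣ T ∣))
  step {walk κ σ x O} (ready , W) (follow {e = e} x≢p parent≡) =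
    let e∉O , W′ = walk-follow G κ W x≢p parent≡ in
    (ready , W′) , ℕ.+-monoˡ-≤ (1 + m + after κ (F σ)) (p⊂q⇒∣p∣<∣q∣ (p⊂q⇒∁p⊃∁q
      (p⊆p∪q ⁅ e ⁆ , e , x∈p∪q⁺ (inj₂ (x∈⁅x⁆ e)) , e∉O)))
  step {walk κ σ x O} (ready , W) flip = flip-feasible ,
    ℕ.≤-trans (ℕ.+-monoʳ-≤ (1 + m) (next-round flip-progress)) (ℕ.m≤n+m _ ∣ ∁ O ∣)
    where open Flip G κ ready W

  run : ∀ {x k y} → Valid x → _—[_]↠_ G x k y → Valid y × k + potential y ≤ potential x
  run valid Defs.[] = valid , ℕ.≤-refl
  run valid (Defs._∷_ {j = j} {k} s ss) =
    let valid₁ , h₁ = step valid s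
        valid₂ , h₂ = run valid₁ ss in
    valid₂ , ℕ.≤-trans (ℕ.≤-reflexive (ℕ.+-assoc j k _)) (ℕ.≤-trans (ℕ.+-monoʳ-≤ j h₂) h₁)

  -- `round` equals `4 + 11 * m + 7 * n`, and there are at most `m` rounds. With `1 ≤ m` the 4
  -- becomes `4 * m` and the final test costs at most `3 * m ^ 2`, whence 18 = 4 + 11 + 3; the 7
  -- comes from `n`.
  initial-potential : ∀ c → 1 ≤ m → n ≤ c * m → ∀ H r → potential (test H r) ≤ (18 + 7 * c) * m ^ 2
  initial-potential c 1≤m n≤cm H r = begin
    ∣ positive G H r ∣ * round + (1 + m + m)
      ≤⟨ ℕ.+-mono-≤ (ℕ.*-mono-≤ (∣p∣≤n (positive G H r)) (ℕ.≤-trans (ℕ.≤-reflexive (round≡ m n))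
           (ℕ.+-mono-≤ (ℕ.+-monoˡ-≤ (11 * m) (ℕ.*-monoʳ-≤ 4 1≤m)) (ℕ.*-monoʳ-≤ 7 n≤cm))))
           (ℕ.≤-trans (ℕ.+-monoˡ-≤ m (ℕ.+-monoˡ-≤ m 1≤m)) (tripled m 1≤m)) ⟩
    m * (4 * m + 11 * m + 7 * (c * m)) + 3 * (m * m)
      ≡⟨ total m c ⟩
    (18 + 7 * c) * m ^ 2 ∎
    where
    open ℕ.≤-Reasoning
    round≡ : ∀ m n → (1 + m + m + m) + ((1 + m + (n + n + n + n) + m) +
      (m + ((3 * n + (m + m)) + (1 + m + (m + (1 + m)))))) ≡ 4 * 1 + 11 * m + 7 * n
    round≡ m n = solveℕ (m ∷ n ∷ [])
    total : ∀ m c → m * (4 * m + 11 * m + 7 * (c * m)) + 3 * (m * m) ≡ (18 + 7 * c) * (m * (m * 1))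
    total m c = solveℕ (m ∷ c ∷ [])
    tripled : ∀ m → 1 ≤ m → m + m + m ≤ 3 * (m * m)
    tripled m 1≤m = subst (_≤ 3 * (m * m)) (thrice m) (ℕ.*-monoʳ-≤ 3 (ℕ.*-monoʳ-≤ m 1≤m))
      where
      thrice : ∀ m → 3 * (m * 1) ≡ m + m + m
      thrice m = solveℕ (m ∷ [])

proposition5 : ∀ (c : ℕ) → ∃[ C ]
    (∀ (G : Graph) (H : Subset (Graph.m G)) (r : Rank G) →
    1 ≤ Graph.m G → Graph.n G ≤ c * Graph.m G →
    MaximalEulerian G H → Conforms G r H →
    (∀ e → e ∈ H → slack G e r ℤ.≤ + Graph.m G) →
    MinAgonyTakesAtMost G H r (C * Graph.m G ^ 2))
proposition5 c = 18 + 7 * c , λ G H r 1≤m n≤cm (eulerian , _) conforms bounded {k} run′ →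
  let valid , k+Φ≤Φ = run G {test H r} (record { eulerian = eulerian ; conforms = conforms ; bounded = bounded }) run′ in
  ℕ.≤-trans (ℕ.m≤m+n k _) (ℕ.≤-trans k+Φ≤Φ (initial-potential G c 1≤m n≤cm H r)) , progress G valid
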